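{- The exponential generating function of the permutations avoiding the partially ordered generalized pattern $3$-$121$-$3$ is $$\sum_{n\ge0} c_n\frac{x^n}{n!}=1+\int\exp\left(\frac{e^{2x}+2x-1}{2}\right)dx,$$ where $c_n$ is the number of permutations in $\mathcal{S}_n$ avoiding $3$-$121$-$3$.
   Context: $\mathcal{S}_n$ is the set of permutations of $\{1,\dots,n\}$, written as words $a_1\dots a_n$ (for $n=0$, the empty permutation). A partially ordered generalized pattern is a word $p_1p_2\dots p_m$ of positive integers (repetitions allowed) with a dash written between some of the consecutive letters. An occurrence of it in $\pi=a_1\dots a_n$ is a subsequence $a_{k_1}\dots a_{k_m}$, $k_1<\dots<k_m$, such that (a) $p_i>p_j$ implies $a_{k_i}>a_{k_j}$ for all $i,j$ (no condition when $p_i=p_j$), and (b) $k_{i+1}=k_i+1$ whenever $p_i$ and $p_{i+1}$ are not separated by a dash. $\pi$ avoids the pattern if it has no occurrence. The formal integral of a power series is $\int\sum_{n\ge0} f_nx^n\,dx=\sum_{n\ge0} f_n\frac{x^{n+1}}{n+1}$. -}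

module Defs where

open import Data.Bool.Base using (Bool; true; false)
open import Data.Bool.Properties using () renaming (_≟_ to _≟ᵇ_)
open import Data.Fin.Base as Fin using (Fin; toℕ; inject₁)
open import Data.Fin.Properties as Fin using (all?)
open import Data.Integer.Base using (+_)
open import Data.List.Base using (List; []; _∷_; length; filter; allFin; cartesianProductWith)
open import Data.List.Membership.Propositional using (_∈_; lose)
open import Data.List.Membership.Propositional.Properties using (∈-allFin; ∈-cartesianProductWith⁺)
open import Data.List.Relation.Unary.Any as Any using (any?; here)
open import Data.Nat.Base as ℕ using (ℕ; zero; suc; _!; _∸_; NonZero)
open import Data.Nat.Properties as ℕ using (_!≢0)
open import Data.Product.Base using (∃; _×_; _,_)
open import Data.Rational.Base as ℚ using (ℚ; 0ℚ; 1ℚ; _/_)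
open import Data.Rational.Properties as ℚ using (+-0-commutativeMonoid)
open import Data.Vec.Base using (Vec; []; _∷_; lookup)
open import Data.Vec.Relation.Unary.All using (All; []; _∷_)
open import Data.Vec.Relation.Unary.AllPairs using (AllPairs; allPairs?)
open import Data.Vec.Relation.Unary.Unique.Propositional using (Unique)
open import Relation.Binary.PropositionalEquality using (_≡_; refl)
open import Relation.Nullary using (¬_)
open import Relation.Nullary.Decidable using (map′; ¬?; _×-dec_; _→-dec_)
open import Relation.Unary using (Decidable)

open import Algebra.Properties.CommutativeMonoid.Sum +-0-commutativeMonoid using (sum-syntax)

------------------------------------------------------------------------
-- Words, permutations and patterns

-- A permutation of {1,…,n} is a word of length n with distinct letters.
-- The letters, and the positions 1,…,n, are represented by Fin n, hence
-- shifted down by one.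
IsPermutation : ∀ {n} → Vec (Fin n) n → Set
IsPermutation = Unique

-- A pattern p₁…pₘ₊₁; the entry of dash at index i (counted from 0) says
-- whether a dash stands between the letters at indices i and i + 1.
record Pattern (m : ℕ) : Set where
  constructor mkPattern
  field
    letters  : Vec ℕ (suc m)
    positive : All NonZero letters
    dash     : Vec Bool m

open Pattern public

record IsOccurrence {m n} (p : Pattern m) (a : Vec (Fin n) n)
                    (k : Vec (Fin n) (suc m)) : Set where
  constructor isOccurrence
  field
    increasing : AllPairs Fin._<_ k
    ordered    : ∀ i j → lookup (letters p) i ℕ.> lookup (letters p) j →
                 lookup a (lookup k i) Fin.> lookup a (lookup k j)
    adjacent   : ∀ (i : Fin m) → lookup (dash p) i ≡ false →
                 toℕ (lookup k (Fin.suc i)) ≡ suc (toℕ (lookup k (inject₁ i)))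

open IsOccurrence public

Avoids : ∀ {m n} → Pattern m → Vec (Fin n) n → Set
Avoids p a = ¬ ∃ (IsOccurrence p a)

3-121-3 : Pattern 4
3-121-3 = mkPattern (3 ∷ 1 ∷ 2 ∷ 1 ∷ 3 ∷ [])
                    (_ ∷ _ ∷ _ ∷ _ ∷ _ ∷ [])
                    (true ∷ false ∷ false ∷ true ∷ [])

------------------------------------------------------------------------
-- Counting

words : ∀ n l → List (Vec (Fin n) l)
words n zero    = [] ∷ []
words n (suc l) = cartesianProductWith _∷_ (allFin n) (words n l)

∈-words : ∀ {n l} (v : Vec (Fin n) l) → v ∈ words n l
∈-words []      = here refl
∈-words (x ∷ v) = ∈-cartesianProductWith⁺ _∷_ (∈-allFin x) (∈-words v)

isPermutation? : ∀ {n} → Decidable (IsPermutation {n})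
isPermutation? = allPairs? (λ x y → ¬? (x Fin.≟ y))

isOccurrence? : ∀ {m n} (p : Pattern m) (a : Vec (Fin n) n) →
                Decidable (IsOccurrence p a)
isOccurrence? p a k =
  map′ (λ (x , y , z) → isOccurrence x y z)
       (λ o → increasing o , ordered o , adjacent o)
       (allPairs? Fin._<?_ k
        ×-dec all? (λ i → all? λ j → (_ ℕ.<? _) →-dec (_ Fin.<? _))
        ×-dec all? (λ i → (_ ≟ᵇ _) →-dec (_ ℕ.≟ _)))

avoids? : ∀ {m n} (p : Pattern m) → Decidable (Avoids {m} {n} p)
avoids? p a = ¬? (map′ Any.satisfied (λ (k , o) → lose (∈-words k) o)
                       (any? (isOccurrence? p a) (words _ _)))

numberAvoiding : ∀ {m} → Pattern m → ℕ → ℕ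
numberAvoiding p n =
  length (filter (λ a → isPermutation? a ×-dec avoids? p a) (words n n))

------------------------------------------------------------------------
-- Formal power series over ℚ; f n is the coefficient of xⁿ.

Series : Set
Series = ℕ → ℚ

infix  4 _≈_
infixl 6 _+_ _-_
infixl 7 _*_
infixr 8 _·_
infixr 9 _^_

_≈_ : Series → Series → Set
f ≈ g = ∀ n → f n ≡ g n

1# : Series
1# zero    = 1ℚ
1# (suc _) = 0ℚ

x : Series
x zero          = 0ℚ
x (suc zero)    = 1ℚ
x (suc (suc _)) = 0ℚ

_+_ _-_ _*_ : Series → Series → Series
(f + g) n = f n ℚ.+ g n
(f - g) n = f n ℚ.- g n
(f * g) n = ∑[ i < suc n ] (f (toℕ i) ℚ.* g (n ∸ toℕ i))

_·_ : ℚ → Series → Series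
(q · f) n = q ℚ.* f n

_^_ : Series → ℕ → Series
f ^ zero  = 1#
f ^ suc k = f * f ^ k

1/_! : ℕ → ℚ
1/ k ! = (+ 1 / k !) {{k !≢0}}

-- ∑ₖ fᵏ / k!, for f with zero constant term: fᵏ then has no term of
-- degree below k, so only k ≤ n contribute to the coefficient of xⁿ.
-- The value is meaningless if f has a nonzero constant term.
exp : Series → Series
exp f n = ∑[ k < suc n ] (1/ (toℕ k) ! ℚ.* (f ^ toℕ k) n)

∫ : Series → Series
∫ f zero    = 0ℚ
∫ f (suc n) = f n ℚ.* (+ 1 / suc n)

egf : (ℕ → ℕ) → Series
egf c n = (+ c n / n !) {{n !≢0}}

2ℚ : ℚ
2ℚ = + 2 / 1

-- A permutation avoids 3-121-3 iff on the left of its maximum every interior peak is a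
-- left-to-right maximum, and on the right, read backwards, likewise.  Build the permutations
-- by inserting smaller and smaller letters.  On each side let e count the left-to-right maxima
-- followed by an ascent (to the next one or to the overall maximum) and v those followed by
-- a descent.  A new minimum keeps the condition exactly in the following places: the outer
-- end of either side (e grows by 1), after one of the e maxima (it moves from e to v), and
-- next to the local minimum after one of the v maxima (2 places, nothing changes).  Hence
-- the number of continuations from (e , v) has the exponential generating function Eᵉ Vᵛ R
-- with V ′ = 2 V, E ′ = V and R ′ = 2 E R, and R is the one for (0 , 0), the permutation 1.
module Submission where

-- A peak left of the maximum always has the maximum as a larger letter on its right, so it is the 2
-- of an occurrence exactly when some earlier letter exceeds it. If no peak is of this kind, the
-- letters after a left-to-right maximum that starts a descent fall to a single local minimum and
-- then rise to the next left-to-right maximum or to the end of the side. A new minimum at any place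
-- of this stretch other than the two beside the local minimum would turn a letter that is no
-- left-to-right maximum into a peak. The obstacle is that an insertion happens inside the word,
-- while the statistics belong to the whole of it. Therefore `(e , v)` is not computed: `run`
-- receives a function `h` of the statistics and returns one of its values or 0. As it is linear in
-- `h`, the sum over all insertions becomes `run` on the old word with `h` replaced by `insert₁ h`,
-- which can be proved by induction on the unread letters. Applying such an operator repeatedly to
-- the constant 1 then counts the continuations without listing any words.

module Scanner where

  open import Data.List.Base using (List; []; _∷_; map)
  open import Data.List.Properties using (map-∘; map-cong)
  open import Data.List.Relation.Unary.All using (All; []; _∷_)
  open import Data.Nat.Base
  open import Data.Nat.ListAction using (sum)
  open import Data.Nat.Properties
  open import Data.Product.Base using (∃₂; _,_)
  open import Data.Sum.Base as Sum using (_⊎_; inj₁; inj₂)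
  open import Data.Nat.Solver using (module +-*-Solver)
  open import Relation.Binary.PropositionalEquality
  open import Relation.Nullary using (yes; no; contradiction)

  -- Scanning one side, and the effect of inserting a new minimum

  inserts : ∀ {A : Set} → A → List A → List (List A)
  inserts z []      = (z ∷ []) ∷ []
  inserts z (c ∷ r) = (z ∷ c ∷ r) ∷ map (c ∷_) (inserts z r)

  Stat : Set
  Stat = ℕ → ℕ → ℕ

  infixl 6 _⊕_
  _⊕_ : Stat → Stat → Stat
  (f ⊕ g) e v = f e v + g e v

  -- e * h (pred e) (suc v): the new minimum is placed right after one of the e maxima;
  -- 2 * v * h e v: next to the local minimum that follows one of the v maxima;
  -- bumpᵉ h: at the outer end.
  bumpᵉ bumpᵛ grow insert₁ : Stat → Stat
  bumpᵉ h e v = h (suc e) v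
  bumpᵛ h e v = h e (suc v)
  grow h e v = e * h (pred e) (suc v) + 2 * v * h e v
  insert₁ h = bumpᵉ h ⊕ grow h

  -- One side of the maximum is read from its outer end towards the maximum.  M is the
  -- largest letter so far.  The last letter is M (top), or it is a smaller letter b that ends
  -- a descent (falling) or an ascent (rising).
  data State : Set where
    start          : State
    top            : ℕ → State
    falling rising : ℕ → ℕ → State

  -- The value is h e v, where e and v count the left-to-right maxima that are followed by
  -- a larger letter (or by nothing) and by a smaller letter respectively; it is 0 if the
  -- word contains a peak smaller than some earlier letter.
  run : State → List ℕ → Stat → ℕ
  run start         []      h = h 0 0
  run start         (c ∷ r) h = run (top c) r h
  run (top M)       []      h = h 1 0
  run (top M)       (c ∷ r) h with M ≤? c
  ... | yes _ = run (top c) r (bumpᵉ h)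
  ... | no  _ = run (falling M c) r (bumpᵛ h)
  run (falling M b) []      h = h 0 0
  run (falling M b) (c ∷ r) h with M ≤? c | b <? c
  ... | yes _ | _     = run (top c) r h
  ... | no  _ | yes _ = run (rising M c) r h
  ... | no  _ | no  _ = run (falling M c) r h
  run (rising M b)  []      h = h 0 0
  run (rising M b)  (c ∷ r) h with M ≤? c | b <? c
  ... | yes _ | _     = run (top c) r h
  ... | no  _ | yes _ = run (rising M c) r h
  ... | no  _ | no  _ = 0

  Outcome : State → List ℕ → Set
  Outcome s r = (∃₂ λ e v → ∀ h → run s r h ≡ h e v) ⊎ (∀ h → run s r h ≡ 0)

  -- The scan never inspects `h`, it only shifts its arguments, so `run s r` is evaluation at a
  -- fixed pair or zero. Congruence and linearity in `h` follow from this without another induction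
  -- on the word.
  outcome : ∀ s r → Outcome s r
  outcome start         []      = inj₁ (0 , 0 , λ _ → refl)
  outcome start         (c ∷ r) = outcome (top c) r
  outcome (top M)       []      = inj₁ (1 , 0 , λ _ → refl)
  outcome (top M)       (c ∷ r) with M ≤? c
  ... | yes _ = Sum.map (λ (e , v , eq) → suc e , v , λ h → eq (bumpᵉ h)) (λ eq h → eq (bumpᵉ h))
                        (outcome (top c) r)
  ... | no  _ = Sum.map (λ (e , v , eq) → e , suc v , λ h → eq (bumpᵛ h)) (λ eq h → eq (bumpᵛ h))
                        (outcome (falling M c) r)
  outcome (falling M b) []      = inj₁ (0 , 0 , λ _ → refl)
  outcome (falling M b) (c ∷ r) with M ≤? c | b <? c
  ... | yes _ | _     = outcome (top c) r
  ... | no  _ | yes _ = outcome (rising M c) r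
  ... | no  _ | no  _ = outcome (falling M c) r
  outcome (rising M b)  []      = inj₁ (0 , 0 , λ _ → refl)
  outcome (rising M b)  (c ∷ r) with M ≤? c | b <? c
  ... | yes _ | _     = outcome (top c) r
  ... | no  _ | yes _ = outcome (rising M c) r
  ... | no  _ | no  _ = inj₂ λ _ → refl

  run-cong : ∀ s r {f g : Stat} → (∀ e v → f e v ≡ g e v) → run s r f ≡ run s r g
  run-cong s r {f} {g} f≡g with outcome s r
  ... | inj₁ (e , v , eq) = trans (eq f) (trans (f≡g e v) (sym (eq g)))
  ... | inj₂ eq           = trans (eq f) (sym (eq g))

  run-⊕ : ∀ s r (f g : Stat) → run s r (f ⊕ g) ≡ run s r f + run s r g
  run-⊕ s r f g with outcome s r
  ... | inj₁ (e , v , eq) = trans (eq (f ⊕ g)) (sym (cong₂ _+_ (eq f) (eq g)))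
  ... | inj₂ eq           = trans (eq (f ⊕ g)) (sym (cong₂ _+_ (eq f) (eq g)))

  suc-state : State → State
  suc-state start         = start
  suc-state (top M)       = top (suc M)
  suc-state (falling M b) = falling (suc M) (suc b)
  suc-state (rising M b)  = rising (suc M) (suc b)

  -- The scan only compares letters. Moving all old letters up, as is done to make room for the new
  -- letter 0, therefore changes nothing.
  run-map-suc : ∀ s r h → run (suc-state s) (map suc r) h ≡ run s r h
  run-map-suc start         []      h = refl
  run-map-suc start         (c ∷ r) h = run-map-suc (top c) r h
  run-map-suc (top M)       []      h = refl
  run-map-suc (top M)       (c ∷ r) h with M ≤? c | suc M ≤? suc c
  ... | yes _   | yes _   = run-map-suc (top c) r (bumpᵉ h)
  ... | yes M≤c | no  M≰c = contradiction (s≤s M≤c) M≰c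
  ... | no  M≰c | yes M≤c = contradiction (s≤s⁻¹ M≤c) M≰c
  ... | no  _   | no  _   = run-map-suc (falling M c) r (bumpᵛ h)
  run-map-suc (falling M b) []      h = refl
  run-map-suc (falling M b) (c ∷ r) h
    with M ≤? c | suc M ≤? suc c | b <? c | suc b <? suc c
  ... | yes _   | yes _   | _       | _       = run-map-suc (top c) r h
  ... | yes M≤c | no  M≰c | _       | _       = contradiction (s≤s M≤c) M≰c
  ... | no  M≰c | yes M≤c | _       | _       = contradiction (s≤s⁻¹ M≤c) M≰c
  ... | no  _   | no  _   | yes _   | yes _   = run-map-suc (rising M c) r h
  ... | no  _   | no  _   | yes b<c | no  b≮c = contradiction (s≤s b<c) b≮c
  ... | no  _   | no  _   | no  b≮c | yes b<c = contradiction (s≤s⁻¹ b<c) b≮c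
  ... | no  _   | no  _   | no  _   | no  _   = run-map-suc (falling M c) r h
  run-map-suc (rising M b)  []      h = refl
  run-map-suc (rising M b)  (c ∷ r) h
    with M ≤? c | suc M ≤? suc c | b <? c | suc b <? suc c
  ... | yes _   | yes _   | _       | _       = run-map-suc (top c) r h
  ... | yes M≤c | no  M≰c | _       | _       = contradiction (s≤s M≤c) M≰c
  ... | no  M≰c | yes M≤c | _       | _       = contradiction (s≤s⁻¹ M≤c) M≰c
  ... | no  _   | no  _   | yes _   | yes _   = run-map-suc (rising M c) r h
  ... | no  _   | no  _   | yes b<c | no  b≮c = contradiction (s≤s b<c) b≮c
  ... | no  _   | no  _   | no  b≮c | yes b<c = contradiction (s≤s⁻¹ b<c) b≮c
  ... | no  _   | no  _   | no  _   | no  _   = refl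

  run-falling-0 : ∀ M c r h → 0 < c → run (falling M 0) (c ∷ r) h ≡ run (rising M 0) (c ∷ r) h
  run-falling-0 M c r h 0<c with M ≤? c | 0 <? c
  ... | yes _ | _       = refl
  ... | no  _ | yes _   = refl
  ... | no  _ | no  0≮c = contradiction 0<c 0≮c

  run-top-∷0 : ∀ M r h → 0 < M → run (top M) (0 ∷ r) h ≡ run (falling M 0) r (bumpᵛ h)
  run-top-∷0 M r h 0<M with M ≤? 0
  ... | yes M≤0 = contradiction 0<M (≤⇒≯ M≤0)
  ... | no  _   = refl

  run-falling-∷0 : ∀ M b r h → 0 < M → run (falling M b) (0 ∷ r) h ≡ run (falling M 0) r h
  run-falling-∷0 M b r h 0<M with M ≤? 0
  ... | yes M≤0 = contradiction 0<M (≤⇒≯ M≤0)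
  ... | no  _   = refl

  -- A new minimum after an ascent makes `b` a peak below `M`, which is forbidden.
  run-rising-∷0 : ∀ M b r h → 0 < M → run (rising M b) (0 ∷ r) h ≡ 0
  run-rising-∷0 M b r h 0<M with M ≤? 0
  ... | yes M≤0 = contradiction 0<M (≤⇒≯ M≤0)
  ... | no  _   = refl

  ∑ : ∀ {A : Set} → List A → (A → ℕ) → ℕ
  ∑ xs f = sum (map f xs)

  ∑-cong : ∀ {A : Set} (xs : List A) {f g : A → ℕ} → (∀ a → f a ≡ g a) → ∑ xs f ≡ ∑ xs g
  ∑-cong xs eq = cong sum (map-cong eq xs)

  ∑-0 : ∀ {A : Set} (xs : List A) → ∑ xs (λ _ → 0) ≡ 0
  ∑-0 []       = refl
  ∑-0 (_ ∷ xs) = ∑-0 xs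

  ∑-inserts-∷ : ∀ z c r (f : List ℕ → ℕ) →
                ∑ (inserts z (c ∷ r)) f ≡ f (z ∷ c ∷ r) + ∑ (inserts z r) (λ r′ → f (c ∷ r′))
  ∑-inserts-∷ z c r f = cong (λ t → f (z ∷ c ∷ r) + sum t) (sym (map-∘ (inserts z r)))

  open +-*-Solver

  -- The extra `bumpᵛ h` is the place right after the left-to-right maximum that `bumpᵉ` has just
  -- counted. For `e = 0` the truncated `pred` gives a wrong argument, but under the factor 0.
  grow-bumpᵉ : ∀ h e v → (bumpᵛ h ⊕ grow (bumpᵉ h)) e v ≡ bumpᵉ (grow h) e v
  grow-bumpᵉ h zero v = solve 2 (λ a b → a :+ b := a :+ con 0 :+ b) refl (h 0 (suc v)) _
  grow-bumpᵉ h (suc e) v =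
    sym (+-assoc (h (suc e) (suc v)) (suc e * h (suc e) (suc v)) (2 * v * h (2 + e) v))

  -- The two extra terms are the places on both sides of the local minimum that belongs to the
  -- maximum just counted by `bumpᵛ`.
  grow-bumpᵛ : ∀ h e v → (bumpᵛ h ⊕ bumpᵛ h ⊕ grow (bumpᵛ h)) e v ≡ bumpᵛ (grow h) e v
  grow-bumpᵛ h e v =
    solve 3 (λ a b w → a :+ a :+ (b :+ con 2 :* w :* a) := b :+ con 2 :* (con 1 :+ w) :* a) refl
      (h e (suc v)) (e * h (pred e) (2 + v)) v

  -- Only from `start` is the outer end still available, hence `insert₁` here and `grow` in the
  -- other states. The four statements are proved together, by splitting off the place before the
  -- next letter.
  ∑-start   : ∀ r → All (0 <_) r → ∀ h →
              ∑ (inserts 0 r) (λ r′ → run start r′ h) ≡ run start r (insert₁ h)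
  ∑-top     : ∀ M r → 0 < M → All (0 <_) r → ∀ h →
              ∑ (inserts 0 r) (λ r′ → run (top M) r′ h) ≡ run (top M) r (grow h)
  -- The first summand makes up for the place to the left of the local minimum, which is
  -- already behind the reading position exactly when b is that minimum.
  ∑-falling : ∀ M b r → 0 < M → All (0 <_) r → ∀ h →
              run (rising M b) r h + ∑ (inserts 0 r) (λ r′ → run (falling M b) r′ h) ≡
              run (falling M b) r (h ⊕ h ⊕ grow h)
  ∑-rising  : ∀ M b r → 0 < M → All (0 <_) r → ∀ h →
              ∑ (inserts 0 r) (λ r′ → run (rising M b) r′ h) ≡ run (rising M b) r (grow h)

  ∑-start [] [] h = refl
  ∑-start (c ∷ r) (0<c ∷ 0<r) h = begin
    ∑ (inserts 0 (c ∷ r)) (λ r′ → run start r′ h)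
      ≡⟨ ∑-inserts-∷ 0 c r (λ r′ → run start r′ h) ⟩
    run (top c) r (bumpᵉ h) + ∑ (inserts 0 r) (λ r′ → run (top c) r′ h)
      ≡⟨ cong (run (top c) r (bumpᵉ h) +_) (∑-top c r 0<c 0<r h) ⟩
    run (top c) r (bumpᵉ h) + run (top c) r (grow h)
      ≡⟨ run-⊕ (top c) r (bumpᵉ h) (grow h) ⟨
    run (top c) r (insert₁ h) ∎
    where open ≡-Reasoning

  ∑-top M [] 0<M [] h =
    cong (_+ 0) (trans (run-top-∷0 M [] h 0<M) (sym (+-identityʳ _)))
  ∑-top M (c ∷ r) 0<M (0<c ∷ 0<r) h = trans
    (∑-inserts-∷ 0 c r (λ r′ → run (top M) r′ h))
    (trans (cong (_+ ∑ (inserts 0 r) (λ r′ → run (top M) (c ∷ r′) h))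
                 (trans (run-top-∷0 M (c ∷ r) h 0<M) (run-falling-0 M c r (bumpᵛ h) 0<c)))
           step)
    where
    step : run (rising M 0) (c ∷ r) (bumpᵛ h) + ∑ (inserts 0 r) (λ r′ → run (top M) (c ∷ r′) h) ≡
           run (top M) (c ∷ r) (grow h)
    step with M ≤? c | 0 <? c
    ... | yes _ | _ = begin
      run (top c) r (bumpᵛ h) + ∑ (inserts 0 r) (λ r′ → run (top c) r′ (bumpᵉ h))
        ≡⟨ cong (run (top c) r (bumpᵛ h) +_) (∑-top c r 0<c 0<r (bumpᵉ h)) ⟩
      run (top c) r (bumpᵛ h) + run (top c) r (grow (bumpᵉ h))
        ≡⟨ run-⊕ (top c) r (bumpᵛ h) (grow (bumpᵉ h)) ⟨
      run (top c) r (bumpᵛ h ⊕ grow (bumpᵉ h))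
        ≡⟨ run-cong (top c) r (grow-bumpᵉ h) ⟩
      run (top c) r (bumpᵉ (grow h)) ∎
      where open ≡-Reasoning
    -- Reading 0 and then `c` ends in `rising M c`, which is exactly the first summand of
    -- `∑-falling`: the place to the left of `c`.
    ... | no _ | yes _ = trans (∑-falling M c r 0<M 0<r (bumpᵛ h))
                               (run-cong (falling M c) r (grow-bumpᵛ h))
    ... | no _ | no 0≮c = contradiction 0<c 0≮c

  ∑-falling M b [] 0<M [] h =
    trans (cong (λ t → h 0 0 + (t + 0)) (run-falling-∷0 M b [] h 0<M))
          (sym (+-assoc (h 0 0) (h 0 0) 0))
  ∑-falling M b (c ∷ r) 0<M (0<c ∷ 0<r) h = trans
    (cong (run (rising M b) (c ∷ r) h +_)
      (trans (∑-inserts-∷ 0 c r (λ r′ → run (falling M b) r′ h))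
             (cong (_+ ∑ (inserts 0 r) (λ r′ → run (falling M b) (c ∷ r′) h))
                   (trans (run-falling-∷0 M b (c ∷ r) h 0<M) (run-falling-0 M c r h 0<c)))))
    step
    where
    -- Used when the next letter is larger, so that `b` is the local minimum: the two copies of
    -- `run s r h` are the places to its left and to its right.
    collect : ∀ s → run s r h + (run s r h + run s r (grow h)) ≡ run s r (h ⊕ h ⊕ grow h)
    collect s = begin
      run s r h + (run s r h + run s r (grow h)) ≡⟨ +-assoc (run s r h) _ _ ⟨
      run s r h + run s r h + run s r (grow h)   ≡⟨ cong (_+ run s r (grow h)) (run-⊕ s r h h) ⟨
      run s r (h ⊕ h) + run s r (grow h)         ≡⟨ run-⊕ s r (h ⊕ h) (grow h) ⟨
      run s r (h ⊕ h ⊕ grow h)                   ∎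
      where open ≡-Reasoning

    step : run (rising M b) (c ∷ r) h +
           (run (rising M 0) (c ∷ r) h + ∑ (inserts 0 r) (λ r′ → run (falling M b) (c ∷ r′) h)) ≡
           run (falling M b) (c ∷ r) (h ⊕ h ⊕ grow h)
    step with M ≤? c | b <? c | 0 <? c
    ... | yes _ | _     | _ =
      trans (cong (λ t → run (top c) r h + (run (top c) r h + t)) (∑-top c r 0<c 0<r h))
            (collect (top c))
    ... | no _  | yes _ | yes _ =
      trans (cong (λ t → run (rising M c) r h + (run (rising M c) r h + t))
                  (∑-rising M c r 0<M 0<r h))
            (collect (rising M c))
    ... | no _  | no _  | yes _   = ∑-falling M c r 0<M 0<r h
    ... | no _  | _     | no  0≮c = contradiction 0<c 0≮c

  ∑-rising M b [] 0<M [] h = cong (_+ 0) (run-rising-∷0 M b [] h 0<M)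
  ∑-rising M b (c ∷ r) 0<M (0<c ∷ 0<r) h = trans
    (∑-inserts-∷ 0 c r (λ r′ → run (rising M b) r′ h))
    (trans (cong (_+ ∑ (inserts 0 r) (λ r′ → run (rising M b) (c ∷ r′) h))
                 (run-rising-∷0 M b (c ∷ r) h 0<M))
           step)
    where
    step : ∑ (inserts 0 r) (λ r′ → run (rising M b) (c ∷ r′) h) ≡ run (rising M b) (c ∷ r) (grow h)
    step with M ≤? c | b <? c
    ... | yes _ | _     = ∑-top c r 0<c 0<r h
    ... | no _  | yes _ = ∑-rising M c r 0<M 0<r h
    ... | no _  | no _  = ∑-0 (inserts 0 r)

-- Peaks with a larger letter on one or both sides, and their detection by the scan

module Peaks where

  open Scanner
  open import Data.Empty using (⊥)
  open import Data.List.Base using (List; []; _∷_; _++_; reverse)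
  open import Data.List.Properties using (reverse-++; reverse-involutive; ∷-injective; ++-assoc)
  open import Data.List.Membership.Propositional using (_∈_; lose; find)
  open import Data.List.Membership.Propositional.Properties using (∈-++⁺ʳ; ∈-++⁺ˡ)
  open import Data.List.Relation.Unary.All as All using (All; []; _∷_)
  import Data.List.Relation.Unary.All.Properties as All
  open import Data.List.Relation.Unary.AllPairs using ([]; _∷_)
  open import Data.List.Relation.Unary.Any as Any using (Any; here; there)
  open import Data.List.Relation.Unary.Any.Properties using (reverse⁺)
  open import Data.List.Relation.Unary.Unique.Propositional using (Unique)
  open import Data.Nat.Base
  open import Data.Nat.Properties
  open import Data.Product.Base using (∃; _,_; _×_)
  open import Data.Sum.Base as Sum using (_⊎_; inj₁; inj₂)
  open import Function.Base using (_∘_; id)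
  open import Relation.Binary.PropositionalEquality
  open import Relation.Nullary using (¬_; yes; no; contradiction)

  -- The condition sees only the letters outside the three consecutive ones, where the two letters 3
  -- of the pattern have to lie.
  Side : Set₁
  Side = List ℕ → ℕ → List ℕ → Set

  record Peak (P : Side) (w : List ℕ) : Set where
    constructor peak
    field
      {before}          : List ℕ
      {a b c}           : ℕ
      {after}           : List ℕ
      split             : w ≡ before ++ a ∷ b ∷ c ∷ after
      a<b               : a < b
      c<b               : c < b
      side              : P before b after

  Leftˢ Rightˢ Both : Side
  Leftˢ  u b s = Any (b <_) u
  Rightˢ u b s = Any (b <_) s
  Both   u b s = Any (b <_) u × Any (b <_) s

  reverse-peak : ∀ {A : Set} (u : List A) a b c s →
                 reverse (u ++ a ∷ b ∷ c ∷ s) ≡ reverse s ++ c ∷ b ∷ a ∷ reverse u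
  reverse-peak u a b c s = begin
    reverse (u ++ a ∷ b ∷ c ∷ s)
      ≡⟨ reverse-++ u (a ∷ b ∷ c ∷ s) ⟩
    reverse (a ∷ b ∷ c ∷ s) ++ reverse u
      ≡⟨ cong (_++ reverse u) (reverse-++ (a ∷ b ∷ c ∷ []) s) ⟩
    (reverse s ++ c ∷ b ∷ a ∷ []) ++ reverse u
      ≡⟨ ++-assoc (reverse s) _ _ ⟩
    reverse s ++ c ∷ b ∷ a ∷ reverse u ∎
    where open ≡-Reasoning

  Peak-Right⇒Left : ∀ {r} → Peak Rightˢ (reverse r) → Peak Leftˢ r
  Peak-Right⇒Left {r} (peak {u} {a} {b} {c} {s} eq a<b c<b b<s) =
    peak {before = reverse s}
         (trans (sym (reverse-involutive r)) (trans (cong reverse eq) (reverse-peak u a b c s)))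
         c<b a<b (reverse⁺ b<s)

  Peak-Left⇒Right : ∀ {r} → Peak Leftˢ r → Peak Rightˢ (reverse r)
  Peak-Left⇒Right (peak {u} {a} {b} {c} {s} refl a<b c<b b<u) =
    peak {before = reverse s} (reverse-peak u a b c s) c<b a<b (reverse⁺ b<u)

  -- The largest letter `N` cannot be `a` or `c`, which are below `b`, so the three letters lie in
  -- `l`, lie in `r` or are centred at `N`. In `l` the part before them is kept, in `r` the part
  -- after them, which is just what `Leftˢ` and `Rightˢ` look at.
  locate : ∀ {N a b c} l r u {s} → All (_< N) l → All (_< N) r → a < b → c < b →
           l ++ N ∷ r ≡ u ++ a ∷ b ∷ c ∷ s →
           (∃ λ s′ → l ≡ u ++ a ∷ b ∷ c ∷ s′) ⊎ b ≡ N ⊎ (∃ λ u′ → r ≡ u′ ++ a ∷ b ∷ c ∷ s)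
  locate []               _ []      _   (b<N ∷ _) N<b _ refl = contradiction N<b (<-asym b<N)
  locate []               r (_ ∷ u) _ _ _ _ refl = inj₂ (inj₂ (u , refl))
  locate (y ∷ [])         r []      _ _ _ _ refl = inj₂ (inj₁ refl)
  locate (y ∷ z ∷ [])     r []      (_ ∷ z<N ∷ _) _ _ N<z refl = contradiction N<z (<-asym z<N)
  locate (y ∷ z ∷ t ∷ l)  r []      _ _ _ _ refl = inj₁ (l , refl)
  locate (y ∷ l)          r (_ ∷ u) (_ ∷ l<N) r<N a<b c<b eq with ∷-injective eq
  ... | refl , eq′ with locate l r u l<N r<N a<b c<b eq′
  ...   | inj₁ (s′ , refl) = inj₁ (s′ , refl)
  ...   | inj₂ rest        = inj₂ rest

  module _ {N l r} (l<N : All (_< N) l) (r<N : All (_< N) r) where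

    Peak-join⁻ : Peak Both (l ++ N ∷ r) → Peak Leftˢ l ⊎ Peak Rightˢ r
    Peak-join⁻ (peak {u} eq a<b c<b (b<u , b<s)) with locate l r u l<N r<N a<b c<b eq
    ... | inj₁ (_ , eq′)        = inj₁ (peak eq′ a<b c<b b<u)
    ... | inj₂ (inj₂ (_ , eq′)) = inj₂ (peak eq′ a<b c<b b<s)
    ... | inj₂ (inj₁ refl) with find b<u
    ...   | y , y∈u , N<y =
      contradiction N<y (≤⇒≯ (All.lookup all≤N (subst (y ∈_) (sym eq) (∈-++⁺ˡ y∈u))))
      where
      all≤N : All (_≤ N) (l ++ N ∷ r)
      all≤N = All.++⁺ (All.map <⇒≤ l<N) (≤-refl ∷ All.map <⇒≤ r<N)

    -- `N` itself supplies the larger letter on the right.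
    Peak-join⁺ˡ : Peak Leftˢ l → Peak Both (l ++ N ∷ r)
    Peak-join⁺ˡ (peak {u} {a} {b} {c} {s} refl a<b c<b b<u) =
      peak {before = u} (++-assoc u _ _) a<b c<b
           (b<u , lose (∈-++⁺ʳ s (here refl)) (All.lookup l<N (∈-++⁺ʳ u (there (here refl)))))

    Peak-join⁺ʳ : Peak Rightˢ r → Peak Both (l ++ N ∷ r)
    Peak-join⁺ʳ (peak {u} {a} {b} {c} {s} refl a<b c<b b<s) =
      peak {before = l ++ N ∷ u} (sym (++-assoc l (N ∷ u) _)) a<b c<b
           (lose (∈-++⁺ʳ l (here refl)) (All.lookup r<N (∈-++⁺ʳ u (there (here refl)))) , b<s)

  -- The letters read so far are q in reverse order, then p, then b.
  Bad : (q : List ℕ) (p b : ℕ) → List ℕ → Set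
  Bad q p b []      = ⊥
  Bad q p b (c ∷ r) = (p < b × c < b × Any (b <_) q) ⊎ Bad (p ∷ q) b c r

  LeftOf : List ℕ → Side
  LeftOf q u b s = Any (b <_) q ⊎ Any (b <_) u

  Bad⇒Peak : ∀ q p b r → Bad q p b r → Peak (LeftOf q) (p ∷ b ∷ r)
  Bad⇒Peak q p b (c ∷ r) (inj₁ (p<b , c<b , b<q)) = peak {before = []} refl p<b c<b (inj₁ b<q)
  Bad⇒Peak q p b (c ∷ r) (inj₂ bad) with Bad⇒Peak (p ∷ q) b c r bad
  ... | peak {u} eq a<b c<b (inj₁ (here b<p))  =
    peak {before = p ∷ u} (cong (p ∷_) eq) a<b c<b (inj₂ (here b<p))
  ... | peak {u} eq a<b c<b (inj₁ (there b<q)) =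
    peak {before = p ∷ u} (cong (p ∷_) eq) a<b c<b (inj₁ b<q)
  ... | peak {u} eq a<b c<b (inj₂ b<u)         =
    peak {before = p ∷ u} (cong (p ∷_) eq) a<b c<b (inj₂ (there b<u))

  Peak⇒Bad : ∀ q p b r → Peak (LeftOf q) (p ∷ b ∷ r) → Bad q p b r
  Peak⇒Bad q p b []      (peak {_ ∷ []}        () _ _ _)
  Peak⇒Bad q p b []      (peak {_ ∷ _ ∷ []}    () _ _ _)
  Peak⇒Bad q p b []      (peak {_ ∷ _ ∷ _ ∷ _} () _ _ _)
  Peak⇒Bad q p b (c ∷ r) (peak {[]}    refl a<b c<b (inj₁ b<q)) = inj₁ (a<b , c<b , b<q)
  Peak⇒Bad q p b (c ∷ r) (peak {y ∷ u} eq   a<b c<b side) with ∷-injective eq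
  ... | refl , eq′ = inj₂ (Peak⇒Bad (p ∷ q) b c r (peak {before = u} eq′ a<b c<b (shuffle side)))
    where
    shuffle : ∀ {b} → LeftOf q (p ∷ u) b [] → LeftOf (p ∷ q) u b []
    shuffle (inj₁ b<q)         = inj₁ (there b<q)
    shuffle (inj₂ (here b<p))  = inj₁ (here b<p)
    shuffle (inj₂ (there b<u)) = inj₂ b<u

  -- The invariant of the scan. `M` is kept as the witness of a larger letter on the left. In a
  -- rising state it must lie in `q`, strictly before the window `p b c`; in a falling state it may
  -- be `p`, which joins `q` at the next step.
  data Scanned : State → List ℕ → ℕ → ℕ → Set where
    top     : ∀ {q p M}   → All (_≤ M) (p ∷ q) → Scanned (top M) q p M
    falling : ∀ {q p M b} → b ≤ p → b < M → M ∈ p ∷ q → All (_≤ M) (p ∷ q) →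
              Scanned (falling M b) q p b
    rising  : ∀ {q p M b} → p < b → b < M → M ∈ q → All (_≤ M) (p ∷ q) →
              Scanned (rising M b) q p b

  -- Constant functions suffice in the good case, because in the end the words are only counted.
  Verdict : State → List ℕ → Set → Set
  Verdict s r B = (B × ∀ h → run s r h ≡ 0) ⊎ (¬ B × ∀ k → run s r (λ _ _ → k) ≡ k)

  later : ∀ {X B E E′ F : Set} → ¬ X → (E → E′) →
          B × E ⊎ ¬ B × F → (X ⊎ B) × E′ ⊎ ¬ (X ⊎ B) × F
  later ¬X f = Sum.map (λ (b , e) → inj₂ b , f e) (λ (¬b , e) → Sum.[ ¬X , ¬b ] , e)

  verdict : ∀ {s q p b} r → Scanned s q p b → Unique (b ∷ r) → Verdict s r (Bad q p b r)
  verdict [] (top _)           _ = inj₂ ((λ ()) , λ _ → refl)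
  verdict [] (falling _ _ _ _) _ = inj₂ ((λ ()) , λ _ → refl)
  verdict [] (rising _ _ _ _)  _ = inj₂ ((λ ()) , λ _ → refl)
  verdict (c ∷ r) (top {q} {p} {M} (p≤M ∷ q≤M)) (_ ∷ cr!) = step
    where
    ¬M<q : ¬ Any (M <_) q
    ¬M<q M<q with find M<q
    ... | y , y∈q , M<y = ≤⇒≯ (All.lookup q≤M y∈q) M<y

    step : Verdict (top M) (c ∷ r) (Bad q p M (c ∷ r))
    step with M ≤? c
    ... | yes M≤c = later (λ (_ , _ , M<q) → ¬M<q M<q) (λ eq h → eq (bumpᵉ h))
                      (verdict r (top (All.map (λ y≤M → ≤-trans y≤M M≤c) (≤-refl ∷ p≤M ∷ q≤M))) cr!)
    ... | no M≰c  = later (λ (_ , _ , M<q) → ¬M<q M<q) (λ eq h → eq (bumpᵛ h))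
                      (verdict r (falling (≰⇒≥ M≰c) (≰⇒> M≰c) (here refl) (≤-refl ∷ p≤M ∷ q≤M)) cr!)
  verdict (c ∷ r) (falling {M = M} {b} b≤p b<M M∈q q≤M) (_ ∷ cr!) with M ≤? c | b <? c
  ... | yes M≤c | _       = later (λ (p<b , _) → ≤⇒≯ b≤p p<b) id
          (verdict r (top (All.map (λ y≤M → ≤-trans y≤M M≤c) (<⇒≤ b<M ∷ q≤M))) cr!)
  ... | no M≰c  | yes b<c = later (λ (p<b , _) → ≤⇒≯ b≤p p<b) id
          (verdict r (rising b<c (≰⇒> M≰c) M∈q (<⇒≤ b<M ∷ q≤M)) cr!)
  ... | no M≰c  | no  b≮c = later (λ (p<b , _) → ≤⇒≯ b≤p p<b) id
          (verdict r (falling (≮⇒≥ b≮c) (≰⇒> M≰c) (there M∈q) (<⇒≤ b<M ∷ q≤M)) cr!)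
  verdict (c ∷ r) (rising {M = M} {b} p<b b<M M∈q q≤M) ((b≢c ∷ _) ∷ cr!) with M ≤? c | b <? c
  ... | yes M≤c | _       = later (λ (_ , c<b , _) → <-asym c<b (<-≤-trans b<M M≤c)) id
          (verdict r (top (All.map (λ y≤M → ≤-trans y≤M M≤c) (<⇒≤ b<M ∷ q≤M))) cr!)
  ... | no M≰c  | yes b<c = later (λ (_ , c<b , _) → <-asym c<b b<c) id
          (verdict r (rising b<c (≰⇒> M≰c) (there M∈q) (<⇒≤ b<M ∷ q≤M)) cr!)
  -- The only place where a peak is found: as the letters are distinct, `b ≮ c` gives `c < b`, and
  -- `M` is the larger letter before.
  ... | no M≰c  | no  b≮c =
          inj₁ (inj₁ (p<b , ≤∧≢⇒< (≮⇒≥ b≮c) (b≢c ∘ sym) , lose M∈q b<M) , λ _ → refl)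

  verdict-start : ∀ r → Unique r → Verdict start r (Peak Leftˢ r)
  verdict-start []          _ =
    inj₂ ((λ { (peak {[]} () _ _ _) ; (peak {_ ∷ _} () _ _ _) }) , λ _ → refl)
  verdict-start (p ∷ [])    _ =
    inj₂ ((λ { (peak {[]} () _ _ _) ; (peak {_ ∷ []} () _ _ _) ; (peak {_ ∷ _ ∷ _} () _ _ _) })
         , λ _ → refl)
  verdict-start (p ∷ b ∷ r) (_ ∷ br!) =
    Sum.map (λ (bad , eq) → fromBad bad , eq) (λ (¬bad , eq) → (λ pk → ¬bad (toBad pk)) , eq) first
    where
    fromBad : Bad [] p b r → Peak Leftˢ (p ∷ b ∷ r)
    fromBad bad with Bad⇒Peak [] p b r bad
    ... | peak {u} eq a<b c<b (inj₂ b<u) = peak {before = u} eq a<b c<b b<u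

    toBad : Peak Leftˢ (p ∷ b ∷ r) → Bad [] p b r
    toBad (peak {u} eq a<b c<b b<u) = Peak⇒Bad [] p b r (peak {before = u} eq a<b c<b (inj₂ b<u))

    -- The first letter has no left neighbour and cannot be a peak, so the invariant is set up after
    -- two letters.
    first : Verdict start (p ∷ b ∷ r) (Bad [] p b r)
    first with p ≤? b
    ... | yes p≤b = Sum.map (λ (bad , eq) → bad , λ h → eq (bumpᵉ h)) id
                            (verdict r (top (p≤b ∷ [])) br!)
    ... | no  p≰b = Sum.map (λ (bad , eq) → bad , λ h → eq (bumpᵛ h)) id
                            (verdict r (falling (≰⇒≥ p≰b) (≰⇒> p≰b) (here refl) (≤-refl ∷ [])) br!)

-- Generating all permutations by inserting minima on the two sides of the maximum

module Arrangements where

  open Scanner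
  open Peaks
  open import Data.List.Base using (List; []; _∷_; _++_; reverse; map; concatMap; upTo)
  open import Data.List.Properties using (map-++; map-∘; map-upTo; ∷-injective; ∷-injectiveʳ)
  open import Data.List.Membership.Propositional using (_∈_; _∉_; lose; find)
  open import Data.List.Membership.Propositional.Properties
  open import Data.List.Relation.Binary.Disjoint.Propositional using (Disjoint)
  open import Data.List.Relation.Binary.Permutation.Propositional
    using (_↭_; ↭-refl; ↭-sym; ↭-trans; ↭-prep; ↭-swap; module PermutationReasoning; ↭-reflexive)
  open import Data.List.Relation.Binary.Permutation.Propositional.Properties
    using (↭-length; shift; drop-∷; ↭-map-inv; map⁺; ∈-resp-↭; ++⁺ʳ; ++⁺ˡ)
  open import Data.List.Relation.Unary.All as All using (All; []; _∷_)
  import Data.List.Relation.Unary.All.Properties as All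
  open import Data.List.Relation.Unary.AllPairs as AllPairs using ([]; _∷_)
  import Data.List.Relation.Unary.AllPairs.Properties as AllPairs
  open import Data.List.Relation.Unary.Any using (here; there)
  open import Data.List.Relation.Unary.Unique.Propositional using (Unique)
  import Data.List.Relation.Unary.Unique.Propositional.Properties as Unique
  open import Data.Nat.Base
  open import Data.Nat.ListAction using (sum)
  open import Data.Nat.ListAction.Properties using (sum-++)
  open import Data.Nat.Properties
  open import Data.Nat.Solver using (module +-*-Solver)
  open import Data.Product.Base using (∃; ∃₂; _,_; _×_)
  open import Data.Product.Properties using (,-injectiveˡ; ,-injectiveʳ)
  open import Data.Sum.Base as Sum using (_⊎_; inj₁; inj₂)
  open import Function.Base using (_∘_)
  open import Relation.Binary.PropositionalEquality
  open import Relation.Nullary using (contradiction)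

  private variable
    X Y : Set

  -- (l , r) stands for the word l ++ n ∷ reverse r, in which n is the largest letter.
  Arrangement : Set
  Arrangement = List ℕ × List ℕ

  -- The new letter is the smallest one, so that all old letters move up.
  children : Arrangement → List Arrangement
  children (l , r) = map (_, map suc r) (inserts 0 (map suc l)) ++
                     map (map suc l ,_) (inserts 0 (map suc r))

  -- The maximum is not stored: these stand for the permutations of `suc n` letters, grown from the
  -- maximum alone.
  arrangements : ℕ → List Arrangement
  arrangements zero    = ([] , []) ∷ []
  arrangements (suc n) = concatMap children (arrangements n)

  weight : Arrangement → Stat → ℕ
  weight (l , r) h = run start l λ e v → run start r λ e′ v′ → h (e + e′) (v + v′)

  -- `grow` is additive over the two sides, but each side has an outer end of its own; hence
  -- `bumpᵉ h` twice in all, which is the factor 2 in the equation for `R`.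
  insert₂ : Stat → Stat
  insert₂ h = bumpᵉ h ⊕ insert₁ h

  ∑-++ : ∀ (xs ys : List X) f → ∑ (xs ++ ys) f ≡ ∑ xs f + ∑ ys f
  ∑-++ xs ys f = trans (cong sum (map-++ f xs ys)) (sum-++ (map f xs) (map f ys))

  ∑-map : ∀ (g : X → Y) xs f → ∑ (map g xs) f ≡ ∑ xs (f ∘ g)
  ∑-map g xs f = cong sum (sym (map-∘ xs))

  ∑-concatMap : ∀ (g : X → List Y) xs f → ∑ (concatMap g xs) f ≡ ∑ xs (λ a → ∑ (g a) f)
  ∑-concatMap g []       f = refl
  ∑-concatMap g (a ∷ xs) f =
    trans (∑-++ (g a) (concatMap g xs) f) (cong (∑ (g a) f +_) (∑-concatMap g xs f))

  ∑-start-suc : ∀ r h → ∑ (inserts 0 (map suc r)) (λ r′ → run start r′ h) ≡ run start r (insert₁ h)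
  ∑-start-suc r h = trans (∑-start (map suc r) (All.map⁺ (All.universal (λ _ → z<s) r)) h)
                    (run-map-suc start r (insert₁ h))

  open +-*-Solver using (solve; _:+_; _:*_; _:=_; con)

  -- `pred e + e′` and `pred (e + e′)` can differ only for `e = 0`, where the factor is 0.
  *-cong-pred-+ : ∀ e e′ (f : ℕ → ℕ) → e * f (pred e + e′) ≡ e * f (pred (e + e′))
  *-cong-pred-+ zero    e′ f = refl
  *-cong-pred-+ (suc e) e′ f = refl

  *-cong-+-pred : ∀ e e′ (f : ℕ → ℕ) → e′ * f (e + pred e′) ≡ e′ * f (pred (e + e′))
  *-cong-+-pred e zero     f = refl
  *-cong-+-pred e (suc e′) f = cong (λ k → suc e′ * f (pred k)) (sym (+-suc e e′))

  insert₁-insert₁ : ∀ h e v e′ v′ →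
    insert₁ (λ e v → h (e + e′) (v + v′)) e v + insert₁ (λ e′ v′ → h (e + e′) (v + v′)) e′ v′ ≡
    insert₂ h (e + e′) (v + v′)
  insert₁-insert₁ h e v e′ v′
    rewrite +-suc e e′ | +-suc v v′
          | *-cong-pred-+ e e′ (λ k → h k (suc (v + v′)))
          | *-cong-+-pred e e′ (λ k → h k (suc (v + v′)))
          | *-distribʳ-+ (h (pred (e + e′)) (suc (v + v′))) e e′ =
    solve 6 (λ p q r s v v′ → p :+ (q :+ con 2 :* v :* s) :+ (p :+ (r :+ con 2 :* v′ :* s)) :=
                              p :+ (p :+ (q :+ r :+ con 2 :* (v :+ v′) :* s))) refl
      (h (suc (e + e′)) (v + v′)) (e * h (pred (e + e′)) (suc (v + v′)))
      (e′ * h (pred (e + e′)) (suc (v + v′))) (h (e + e′) (v + v′)) v v′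

  ∑-children : ∀ p h → ∑ (children p) (λ p′ → weight p′ h) ≡ weight p (insert₂ h)
  ∑-children (l , r) h = begin
    ∑ (children (l , r)) (λ p → weight p h)
      ≡⟨ ∑-++ (map (_, map suc r) (inserts 0 (map suc l))) _ _ ⟩
    ∑ (map (_, map suc r) (inserts 0 (map suc l))) (λ p → weight p h) +
    ∑ (map (map suc l ,_) (inserts 0 (map suc r))) (λ p → weight p h)
      ≡⟨ cong₂ _+_ (∑-map (_, map suc r) (inserts 0 (map suc l)) (λ p → weight p h))
                   (∑-map (map suc l ,_) (inserts 0 (map suc r)) (λ p → weight p h)) ⟩
    ∑ (inserts 0 (map suc l)) (λ l′ → weight (l′ , map suc r) h) +
    ∑ (inserts 0 (map suc r)) (λ r′ → weight (map suc l , r′) h)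
      ≡⟨ cong₂ _+_ inl inr ⟩
    run start l (insert₁ (λ e v → run start r (λ e′ v′ → h (e + e′) (v + v′)))) +
    run start l (λ e v → run start r (insert₁ (λ e′ v′ → h (e + e′) (v + v′))))
      ≡⟨ run-⊕ start l _ _ ⟨
    run start l (insert₁ (λ e v → run start r (λ e′ v′ → h (e + e′) (v + v′))) ⊕
                 (λ e v → run start r (insert₁ (λ e′ v′ → h (e + e′) (v + v′)))))
      ≡⟨ run-cong start l both ⟩
    weight (l , r) (insert₂ h) ∎
    where
    open ≡-Reasoning
    inl : ∑ (inserts 0 (map suc l)) (λ l′ → weight (l′ , map suc r) h) ≡
          run start l (insert₁ (λ e v → run start r (λ e′ v′ → h (e + e′) (v + v′))))
    inl = trans (∑-cong (inserts 0 (map suc l)) λ l′ →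
                   run-cong start l′ λ e v → run-map-suc start r _)
                (∑-start-suc l _)

    inr : ∑ (inserts 0 (map suc r)) (λ r′ → weight (map suc l , r′) h) ≡
          run start l (λ e v → run start r (insert₁ (λ e′ v′ → h (e + e′) (v + v′))))
    inr = trans (∑-cong (inserts 0 (map suc r)) λ r′ → run-map-suc start l _)
                (by-outcome (outcome start l))
      where
      -- The sum over `r′` has to pass inside the outer scan of `l`; it can, because that scan is an
      -- evaluation or zero.
      by-outcome : Outcome start l → ∑ (inserts 0 (map suc r)) (λ r′ → weight (l , r′) h) ≡
               run start l (λ e v → run start r (insert₁ (λ e′ v′ → h (e + e′) (v + v′))))
      by-outcome (inj₁ (e , v , eq)) =
        trans (∑-cong (inserts 0 (map suc r)) λ r′ → eq _) (trans (∑-start-suc r _) (sym (eq _)))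
      by-outcome (inj₂ eq) =
        trans (∑-cong (inserts 0 (map suc r)) λ r′ → eq _)
              (trans (∑-0 (inserts 0 (map suc r))) (sym (eq _)))

    both : ∀ e v → (insert₁ (λ e v → run start r (λ e′ v′ → h (e + e′) (v + v′))) ⊕
                    (λ e v → run start r (insert₁ (λ e′ v′ → h (e + e′) (v + v′))))) e v ≡
                   run start r (λ e′ v′ → insert₂ h (e + e′) (v + v′))
    both e v with outcome start r
    ... | inj₁ (e′ , v′ , eq)
      rewrite eq (λ e′ v′ → h (suc e + e′) (v + v′)) | eq (λ e′ v′ → h (pred e + e′) (suc v + v′))
            | eq (λ e′ v′ → h (e + e′) (v + v′)) | eq (insert₁ (λ e′ v′ → h (e + e′) (v + v′)))
            | eq (λ e′ v′ → insert₂ h (e + e′) (v + v′))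
      = insert₁-insert₁ h e v e′ v′
    ... | inj₂ eq
      rewrite eq (λ e′ v′ → h (suc e + e′) (v + v′)) | eq (λ e′ v′ → h (pred e + e′) (suc v + v′))
            | eq (λ e′ v′ → h (e + e′) (v + v′)) | eq (insert₁ (λ e′ v′ → h (e + e′) (v + v′)))
            | eq (λ e′ v′ → insert₂ h (e + e′) (v + v′))
            | *-zeroʳ e | *-zeroʳ (2 * v)
      = refl

  -- The number of ways to insert `n` more letters, starting from the statistics `(e , v)`, without
  -- violating the condition.
  total : ℕ → Stat
  total zero    _ _ = 1
  total (suc n) = insert₂ (total n)

  -- With `m` general, one generation of words can be traded for one more `insert₂`. For `m = 0` the
  -- left side counts the good arrangements.
  ∑-arrangements : ∀ m n → ∑ (arrangements n) (λ p → weight p (total m)) ≡ total (n + m) 0 0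
  ∑-arrangements m zero    = +-identityʳ _
  ∑-arrangements m (suc n) = begin
    ∑ (arrangements (suc n)) (λ p → weight p (total m))
      ≡⟨ ∑-concatMap children (arrangements n) _ ⟩
    ∑ (arrangements n) (λ p → ∑ (children p) (λ p′ → weight p′ (total m)))
      ≡⟨ ∑-cong (arrangements n) (λ p → ∑-children p (total m)) ⟩
    ∑ (arrangements n) (λ p → weight p (total (suc m)))
      ≡⟨ ∑-arrangements (suc m) n ⟩
    total (n + suc m) 0 0
      ≡⟨ cong (λ k → total k 0 0) (+-suc n m) ⟩
    total (suc n + m) 0 0 ∎
    where open ≡-Reasoning

  inserts-↭ : ∀ {z : X} {w w′} → w′ ∈ inserts z w → w′ ↭ z ∷ w
  inserts-↭ {w = []}    (here refl) = ↭-refl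
  inserts-↭ {w = c ∷ w} (here refl) = ↭-refl
  inserts-↭ {w = c ∷ w} (there w′∈) with ∈-map⁻ (c ∷_) w′∈
  ... | _ , u∈ , refl = ↭-trans (↭-prep c (inserts-↭ u∈)) (↭-swap _ _ ↭-refl)

  ∈-inserts : ∀ (z : X) u s → u ++ z ∷ s ∈ inserts z (u ++ s)
  ∈-inserts z []      []      = here refl
  ∈-inserts z []      (_ ∷ _) = here refl
  ∈-inserts z (c ∷ u) s       = there (∈-map⁺ (c ∷_) (∈-inserts z u s))

  head-map-∷ : ∀ {y z : X} {t : List X} {us : List (List X)} → z ∷ t ∈ map (y ∷_) us → z ≡ y
  head-map-∷ {us = _ ∷ _} (here refl) = refl
  head-map-∷ {us = _ ∷ _} (there p)   = head-map-∷ p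

  inserts-! : ∀ {z : X} {w} → z ∉ w → Unique (inserts z w)
  inserts-! {w = []}    z∉w = [] ∷ []
  inserts-! {w = c ∷ w} z∉w =
    All.tabulate (λ { u∈ refl → z∉w (here (head-map-∷ u∈)) }) ∷
    Unique.map⁺ ∷-injectiveʳ (inserts-! (z∉w ∘ there))

  0∉map-suc : ∀ l → 0 ∉ map suc l
  0∉map-suc l 0∈ with ∈-map⁻ suc 0∈
  ... | _ , _ , ()

  -- Undoes an insertion of 0. It recovers the parent from any child, so different parents have no
  -- child in common.
  unsuc : List ℕ → List ℕ
  unsuc []          = []
  unsuc (zero ∷ w)  = unsuc w
  unsuc (suc c ∷ w) = c ∷ unsuc w

  unsuc-map-suc : ∀ l → unsuc (map suc l) ≡ l
  unsuc-map-suc []      = refl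
  unsuc-map-suc (c ∷ l) = cong (c ∷_) (unsuc-map-suc l)

  unsuc-inserts : ∀ l {l′} → l′ ∈ inserts 0 (map suc l) → unsuc l′ ≡ l
  unsuc-inserts []      (here refl) = refl
  unsuc-inserts (c ∷ l) (here refl) = cong (c ∷_) (unsuc-map-suc l)
  unsuc-inserts (c ∷ l) (there l′∈) with ∈-map⁻ (suc c ∷_) l′∈
  ... | _ , u∈ , refl = cong (c ∷_) (unsuc-inserts l u∈)

  children-cases : ∀ l r {p} → p ∈ children (l , r) →
    (∃ λ l′ → l′ ∈ inserts 0 (map suc l) × p ≡ (l′ , map suc r)) ⊎
    (∃ λ r′ → r′ ∈ inserts 0 (map suc r) × p ≡ (map suc l , r′))
  children-cases l r p∈ =
    Sum.map (∈-map⁻ _) (∈-map⁻ _) (∈-++⁻ (map (_, map suc r) (inserts 0 (map suc l))) p∈)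

  parent : Arrangement → Arrangement
  parent (l , r) = unsuc l , unsuc r

  parent-children : ∀ {p q} → q ∈ children p → parent q ≡ p
  parent-children {l , r} q∈ with children-cases l r q∈
  ... | inj₁ (_ , l′∈ , refl) = cong₂ _,_ (unsuc-inserts l l′∈) (unsuc-map-suc r)
  ... | inj₂ (_ , r′∈ , refl) = cong₂ _,_ (unsuc-map-suc l) (unsuc-inserts r r′∈)

  children-! : ∀ p → Unique (children p)
  children-! (l , r) = Unique.++⁺
    (Unique.map⁺ ,-injectiveˡ (inserts-! (0∉map-suc l)))
    (Unique.map⁺ ,-injectiveʳ (inserts-! (0∉map-suc r)))
    disjoint
    where
    disjoint : Disjoint (map (_, map suc r) (inserts 0 (map suc l)))
                        (map (map suc l ,_) (inserts 0 (map suc r)))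
    disjoint (p∈ , q∈) with ∈-map⁻ _ p∈ | ∈-map⁻ _ q∈
    ... | l′ , l′∈ , refl | _ , _ , eq =
      0∉map-suc l (subst (0 ∈_) (,-injectiveˡ eq) (∈-resp-↭ (↭-sym (inserts-↭ l′∈)) (here refl)))

  children-disjoint : ∀ {p q} → p ≢ q → Disjoint (children p) (children q)
  children-disjoint p≢q (z∈p , z∈q) = p≢q (trans (sym (parent-children z∈p)) (parent-children z∈q))

  arrangements-! : ∀ n → Unique (arrangements n)
  arrangements-! zero    = [] ∷ []
  arrangements-! (suc n) = Unique.concat⁺
    (All.map⁺ (All.universal children-! (arrangements n)))
    (AllPairs.map⁺ (AllPairs.map children-disjoint (arrangements-! n)))

  upTo-suc : ∀ n → upTo (suc n) ≡ 0 ∷ map suc (upTo n)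
  upTo-suc n = cong (0 ∷_) (sym (map-upTo suc n))

  arrangement⇒↭ : ∀ n {l r} → (l , r) ∈ arrangements n → l ++ r ↭ upTo n
  arrangement⇒↭ zero    (here refl) = ↭-refl
  arrangement⇒↭ (suc n) p∈ with find (∈-concatMap⁻ children {xs = arrangements n} p∈)
  ... | (l , r) , q∈ , p∈q with arrangement⇒↭ n q∈ | children-cases l r p∈q
  ...   | l++r | inj₁ (l′ , l′∈ , refl) = begin
    l′ ++ map suc r                ↭⟨ ++⁺ʳ (map suc r) (inserts-↭ l′∈) ⟩
    0 ∷ map suc l ++ map suc r     ≡⟨ cong (0 ∷_) (map-++ suc l r) ⟨
    0 ∷ map suc (l ++ r)           ↭⟨ ↭-prep 0 (map⁺ suc l++r) ⟩
    0 ∷ map suc (upTo n)           ≡⟨ upTo-suc n ⟨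
    upTo (suc n)                   ∎
    where open PermutationReasoning
  ...   | l++r | inj₂ (r′ , r′∈ , refl) = begin
    map suc l ++ r′                ↭⟨ ++⁺ˡ (map suc l) (inserts-↭ r′∈) ⟩
    map suc l ++ 0 ∷ map suc r     ↭⟨ shift 0 (map suc l) (map suc r) ⟩
    0 ∷ map suc l ++ map suc r     ≡⟨ cong (0 ∷_) (map-++ suc l r) ⟨
    0 ∷ map suc (l ++ r)           ↭⟨ ↭-prep 0 (map⁺ suc l++r) ⟩
    0 ∷ map suc (upTo n)           ≡⟨ upTo-suc n ⟨
    upTo (suc n)                   ∎
    where open PermutationReasoning

  map-≡-++ : ∀ (f : X → Y) zs us {vs} → map f zs ≡ us ++ vs →
             ∃₂ λ xs ys → zs ≡ xs ++ ys × us ≡ map f xs × vs ≡ map f ys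
  map-≡-++ f zs       []       eq = [] , zs , refl , refl , sym eq
  map-≡-++ f (z ∷ zs) (u ∷ us) eq with ∷-injective eq
  ... | refl , eq′ with map-≡-++ f zs us eq′
  ...   | xs , ys , refl , refl , refl = z ∷ xs , ys , refl , refl , refl

  -- The letter 0 is deleted from the side that contains it; what remains is a rearrangement of
  -- successors, hence `map suc` of a smaller arrangement.
  ↭⇒arrangement : ∀ n {l r} → l ++ r ↭ upTo n → (l , r) ∈ arrangements n
  ↭⇒arrangement zero {[]} {[]} _ = here refl
  ↭⇒arrangement zero {[]} {_ ∷ _} ↭ = contradiction (↭-length ↭) λ ()
  ↭⇒arrangement zero {_ ∷ _}  ↭ = contradiction (↭-length ↭) λ ()
  ↭⇒arrangement (suc n) {l} {r} l++r =
    Sum.[ inˡ , inʳ ] (∈-++⁻ l (∈-resp-↭ (↭-sym l++r) (here refl)))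
    where
    pull : ∀ l r → l ++ r ↭ map suc (upTo n) →
           ∃₂ λ l₀ r₀ → (l₀ , r₀) ∈ arrangements n × l ≡ map suc l₀ × r ≡ map suc r₀
    pull l r p with ↭-map-inv suc (↭-sym p)
    ... | zs , eq , p′ with map-≡-++ suc zs l (sym eq)
    ...   | l₀ , r₀ , refl , refl , refl = l₀ , r₀ , ↭⇒arrangement n (↭-sym p′) , refl , refl

    child : ∀ {p q} → p ∈ arrangements n → q ∈ children p → q ∈ arrangements (suc n)
    child p∈ q∈ = ∈-concatMap⁺ children (lose p∈ q∈)

    inˡ : 0 ∈ l → (l , r) ∈ arrangements (suc n)
    inˡ 0∈l with ∈-∃++ 0∈l
    ... | u , s , refl with pull (u ++ s) r
          (drop-∷ (↭-trans (++⁺ʳ r (↭-sym (shift 0 u s))) (↭-trans l++r (↭-reflexive (upTo-suc n)))))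
    ...   | l₀ , r₀ , p∈ , eqˡ , refl =
      child p∈ (∈-++⁺ˡ (∈-map⁺ (_, map suc r₀)
        (subst (λ w → u ++ 0 ∷ s ∈ inserts 0 w) eqˡ (∈-inserts 0 u s))))

    inʳ : 0 ∈ r → (l , r) ∈ arrangements (suc n)
    inʳ 0∈r with ∈-∃++ 0∈r
    ... | u , s , refl with pull l (u ++ s)
          (drop-∷ (↭-trans (↭-sym (shift 0 l (u ++ s)))
                  (↭-trans (++⁺ˡ l (↭-sym (shift 0 u s))) (↭-trans l++r (↭-reflexive (upTo-suc n))))))
    ...   | l₀ , r₀ , p∈ , refl , eqʳ =
      child p∈ (∈-++⁺ʳ (map (_, map suc r₀) (inserts 0 (map suc l₀)))
        (∈-map⁺ (map suc l₀ ,_) (subst (λ w → u ++ 0 ∷ s ∈ inserts 0 w) eqʳ (∈-inserts 0 u s))))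

-- From occurrences of the pattern to peaks, and from avoiders to arrangements

module Counting where

  open Scanner
  open Peaks
  open Arrangements
  open import Defs
    using (IsPermutation; isPermutation?; IsOccurrence; isOccurrence; Avoids; avoids?; 3-121-3;
           numberAvoiding; words; ∈-words)

  open import Data.Bool.Base using (false)
  open import Data.Fin.Base as Fin using (Fin; zero; suc; toℕ; fromℕ<)
  import Data.Fin.Properties as Fin
  open import Data.List.Base using (List; []; _∷_; _++_; reverse; length; map; filter; upTo)
  open import Data.List.Properties
    using (∷-injective; ∷-injectiveˡ; ∷-injectiveʳ; length-map; upTo-∷ʳ;
           reverse-involutive; reverse-injective; ++-identityʳ; length-upTo; length-++)
  open import Data.List.Membership.Propositional using (_∈_; _∉_; lose; find)
  open import Data.List.Membership.Propositional.Properties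
  open import Data.List.Relation.Binary.Permutation.Propositional
    using (_↭_; ↭-refl; ↭-sym; ↭-trans; ↭-prep; ↭-reflexive; ↭⇒↭ₛ; module PermutationReasoning)
  open import Data.List.Relation.Binary.Permutation.Propositional.Properties
    using (↭-length; shift; drop-mid; All-resp-↭; ∈-resp-↭; ++⁺ˡ; ↭-reverse; ++-comm)
  open import Data.List.Relation.Binary.Subset.Propositional using (_⊆_)
  open import Data.List.Relation.Unary.All as All using (All; []; _∷_)
  import Data.List.Relation.Unary.All.Properties as All
  open import Data.List.Relation.Unary.AllPairs using ([]; _∷_)
  open import Data.List.Relation.Unary.Any using (here; there)
  open import Data.List.Relation.Unary.Unique.Propositional using (Unique)
  import Data.List.Relation.Unary.Unique.Propositional.Properties as Unique
  open import Data.Nat.Base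
  open import Data.Nat.Properties
  open import Data.Product.Base using (∃; _,_; _×_; proj₁; proj₂)
  open import Data.Sum.Base as Sum using (_⊎_; inj₁; inj₂)
  open import Data.Vec.Base using (Vec; []; _∷_; lookup)
  import Data.Vec.Properties as Vec using (∷-injective)
  import Data.Vec.Relation.Unary.All as Vec using (All; []; _∷_)
  import Data.Vec.Relation.Unary.AllPairs as Vecₚ
  import Data.Vec.Relation.Unary.Unique.Propositional as Vec using (Unique)
  open import Function.Base using (_∘_)
  open import Relation.Binary.PropositionalEquality
  open import Relation.Nullary using (¬_; Dec; contradiction)
  open import Relation.Nullary.Decidable using (_×-dec_)

  private variable
    X Y : Set
    k n : ℕ

  letters : Vec (Fin n) k → List ℕ
  letters []      = []
  letters (c ∷ a) = toℕ c ∷ letters a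

  -- Positions are natural numbers here, so that they can be moved along `++` without bounds.
  data _[_]≡_ {X : Set} : List X → ℕ → X → Set where
    here  : ∀ {c w}     → (c ∷ w) [ 0 ]≡ c
    there : ∀ {c w i d} → w [ i ]≡ d → (c ∷ w) [ suc i ]≡ d

  letters-lookup : ∀ (a : Vec (Fin n) k) i → letters a [ toℕ i ]≡ toℕ (lookup a i)
  letters-lookup (_ ∷ _) zero    = here
  letters-lookup (_ ∷ a) (suc i) = there (letters-lookup a i)

  lookup-letters : ∀ (a : Vec (Fin n) k) {i d} → letters a [ i ]≡ d →
                   ∃ λ j → toℕ j ≡ i × toℕ (lookup a j) ≡ d
  lookup-letters (_ ∷ _) here = zero , refl , refl
  lookup-letters (_ ∷ a) (there p) with lookup-letters a p
  ... | j , refl , refl = suc j , refl , refl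

  []≡⇒∈ : ∀ {w : List X} {i d} → w [ i ]≡ d → d ∈ w
  []≡⇒∈ here      = here refl
  []≡⇒∈ (there p) = there ([]≡⇒∈ p)

  ∈⇒[]≡ : ∀ {w : List X} {d} → d ∈ w → ∃ λ i → i < length w × w [ i ]≡ d
  ∈⇒[]≡ (here refl) = 0 , z<s , here
  ∈⇒[]≡ (there d∈w) with ∈⇒[]≡ d∈w
  ... | i , i< , p = suc i , s<s i< , there p

  []≡-++ˡ : ∀ {u : List X} s {i d} → u [ i ]≡ d → (u ++ s) [ i ]≡ d
  []≡-++ˡ s here      = here
  []≡-++ˡ s (there p) = there ([]≡-++ˡ s p)

  []≡-++ʳ : ∀ (u : List X) {s i d} → s [ i ]≡ d → (u ++ s) [ length u + i ]≡ d
  []≡-++ʳ []      p = p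
  []≡-++ʳ (_ ∷ u) p = there ([]≡-++ʳ u p)

  -- Links positions, in which occurrences are defined, with splittings of the word, in which peaks
  -- are: `left` and `right` turn the dashes of the pattern into membership in the outer parts.
  record Window (w : List X) (j : ℕ) (a b c : X) : Set where
    constructor window
    field
      {u s}  : List X
      split  : w ≡ u ++ a ∷ b ∷ c ∷ s
      left   : ∀ {i d} → i < j → w [ i ]≡ d → d ∈ u
      right  : ∀ {i d} → 2 + j < i → w [ i ]≡ d → d ∈ s

  []≡⇒Window : ∀ {w : List X} {j a b c} →
               w [ j ]≡ a → w [ 1 + j ]≡ b → w [ 2 + j ]≡ c → Window w j a b c
  []≡⇒Window here (there here) (there (there here)) = window {u = []} refl (λ ()) right
    where
    right : ∀ {w : List X} {i a b c d} → 2 < i → (a ∷ b ∷ c ∷ w) [ i ]≡ d → d ∈ w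
    right (s<s (s<s (s<s _))) (there (there (there p))) = []≡⇒∈ p
  []≡⇒Window {w = y ∷ _} (there p) (there q) (there r) with []≡⇒Window p q r
  ... | window {u} refl left right =
    window {u = y ∷ u} refl
      (λ { _ here → here refl ; (s<s i<) (there p) → there (left i< p) })
      (λ { (s<s <i) (there p) → right <i p })

  Occurrence⇒Peak : ∀ {a : Vec (Fin n) n} {k} → IsOccurrence 3-121-3 a k → Peak Both (letters a)
  Occurrence⇒Peak {a = a} {k₀ ∷ k₁ ∷ k₂ ∷ k₃ ∷ k₄ ∷ []}
    (isOccurrence ((k₀<k₁ Vec.∷ _) Vecₚ.∷ _ Vecₚ.∷ _ Vecₚ.∷ (k₃<k₄ Vec.∷ _) Vecₚ.∷ _)
                  ordered adjacent)
    -- The two places without a dash make the three middle positions consecutive.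
    with adjacent (suc zero) refl
  ... | k₂≡1+k₁ with trans (adjacent (suc (suc zero)) refl) (cong suc k₂≡1+k₁)
  ... | k₃≡2+k₁ with []≡⇒Window (letters-lookup a k₁)
                       (subst (letters a [_]≡ toℕ (lookup a k₂)) k₂≡1+k₁ (letters-lookup a k₂))
                       (subst (letters a [_]≡ toℕ (lookup a k₃)) k₃≡2+k₁ (letters-lookup a k₃))
  ... | window split left right = peak split
    (ordered (suc (suc zero)) (suc zero) (s≤s (s≤s z≤n)))
    (ordered (suc (suc zero)) (suc (suc (suc zero))) (s≤s (s≤s z≤n)))
    ( lose (left k₀<k₁ (letters-lookup a k₀)) (ordered zero (suc (suc zero)) ≤-refl)
    , lose (right (subst (_< _) k₃≡2+k₁ k₃<k₄) (letters-lookup a k₄))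
           (ordered (suc (suc (suc (suc zero)))) (suc (suc zero)) ≤-refl))

  lookup-letters≡ : ∀ (a : Vec (Fin n) k) {w i d} → letters a ≡ w → w [ i ]≡ d →
                    ∃ λ j → toℕ j ≡ i × toℕ (lookup a j) ≡ d
  lookup-letters≡ a refl = lookup-letters a

  toℕ-< : ∀ {i j} {p q : Fin n} → toℕ p ≡ i → toℕ q ≡ j → i < j → p Fin.< q
  toℕ-< refl refl i<j = i<j

  Peak⇒Occurrence : ∀ (a : Vec (Fin n) n) → Peak Both (letters a) → ∃ (IsOccurrence 3-121-3 a)
  Peak⇒Occurrence a (peak {u} {x} {y} {z} {s} eq x<y z<y (y<u , y<s))
    with find y<u | find y<s
  ... | d , d∈u , y<d | e , e∈s , y<e
    with ∈⇒[]≡ d∈u | ∈⇒[]≡ e∈s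
  ... | i , i<u , u[i]≡d | j , _ , s[j]≡e
    with lookup-letters≡ a eq ([]≡-++ˡ _ u[i]≡d)
       | lookup-letters≡ a eq ([]≡-++ʳ u here)
       | lookup-letters≡ a eq ([]≡-++ʳ u (there here))
       | lookup-letters≡ a eq ([]≡-++ʳ u (there (there here)))
       | lookup-letters≡ a eq ([]≡-++ʳ u (there (there (there s[j]≡e))))
  ... | k₀ , k₀≡ , refl | k₁ , k₁≡ , refl | k₂ , k₂≡ , refl | k₃ , k₃≡ , refl | k₄ , k₄≡ , refl =
    (k₀ ∷ k₁ ∷ k₂ ∷ k₃ ∷ k₄ ∷ []) , isOccurrence increasing ordered adjacent
    where
    <₀₁ : k₀ Fin.< k₁
    <₀₁ = toℕ-< k₀≡ k₁≡ (<-≤-trans i<u (m≤m+n (length u) 0))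
    <₁₂ : k₁ Fin.< k₂
    <₁₂ = toℕ-< k₁≡ k₂≡ (+-monoʳ-< (length u) ≤-refl)
    <₂₃ : k₂ Fin.< k₃
    <₂₃ = toℕ-< k₂≡ k₃≡ (+-monoʳ-< (length u) ≤-refl)
    <₃₄ : k₃ Fin.< k₄
    <₃₄ = toℕ-< k₃≡ k₄≡ (+-monoʳ-< (length u) (s≤s (s≤s (s≤s z≤n))))
    <₀₂ = Fin.<-trans <₀₁ <₁₂
    <₀₃ = Fin.<-trans <₀₂ <₂₃
    <₁₃ = Fin.<-trans <₁₂ <₂₃
    <₂₄ = Fin.<-trans <₂₃ <₃₄

    increasing : Vecₚ.AllPairs Fin._<_ (k₀ ∷ k₁ ∷ k₂ ∷ k₃ ∷ k₄ ∷ [])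
    increasing = (<₀₁ Vec.∷ <₀₂ Vec.∷ <₀₃ Vec.∷ Fin.<-trans <₀₂ <₂₄ Vec.∷ Vec.[]) Vecₚ.∷
                 (<₁₂ Vec.∷ <₁₃ Vec.∷ Fin.<-trans <₁₂ <₂₄ Vec.∷ Vec.[]) Vecₚ.∷
                 (<₂₃ Vec.∷ <₂₄ Vec.∷ Vec.[]) Vecₚ.∷
                 (<₃₄ Vec.∷ Vec.[]) Vecₚ.∷ Vec.[] Vecₚ.∷ Vecₚ.[]

    pattern #0 = zero
    pattern #1 = suc zero
    pattern #2 = suc (suc zero)
    pattern #3 = suc (suc (suc zero))
    pattern #4 = suc (suc (suc (suc zero)))

    p = Defs.letters 3-121-3

    ordered : ∀ i j → lookup p i > lookup p j →
              lookup a (lookup (k₀ ∷ k₁ ∷ k₂ ∷ k₃ ∷ k₄ ∷ []) i) Fin.>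
              lookup a (lookup (k₀ ∷ k₁ ∷ k₂ ∷ k₃ ∷ k₄ ∷ []) j)
    ordered #0 #1 _ = <-trans x<y y<d
    ordered #0 #2 _ = y<d
    ordered #0 #3 _ = <-trans z<y y<d
    ordered #2 #1 _ = x<y
    ordered #2 #3 _ = z<y
    ordered #4 #1 _ = <-trans x<y y<e
    ordered #4 #2 _ = y<e
    ordered #4 #3 _ = <-trans z<y y<e
    ordered #0 #0 (s≤s (s≤s (s≤s ())))
    ordered #0 #4 (s≤s (s≤s (s≤s ())))
    ordered #4 #0 (s≤s (s≤s (s≤s ())))
    ordered #4 #4 (s≤s (s≤s (s≤s ())))
    ordered #2 #0 (s≤s (s≤s ()))
    ordered #2 #2 (s≤s (s≤s ()))
    ordered #2 #4 (s≤s (s≤s ()))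
    ordered #1 #0 (s≤s ())
    ordered #1 #1 (s≤s ())
    ordered #1 #2 (s≤s ())
    ordered #1 #3 (s≤s ())
    ordered #1 #4 (s≤s ())
    ordered #3 #0 (s≤s ())
    ordered #3 #1 (s≤s ())
    ordered #3 #2 (s≤s ())
    ordered #3 #3 (s≤s ())
    ordered #3 #4 (s≤s ())

    adjacent : ∀ (i : Fin 4) → lookup (Defs.dash 3-121-3) i ≡ false →
               toℕ (lookup (k₀ ∷ k₁ ∷ k₂ ∷ k₃ ∷ k₄ ∷ []) (suc i)) ≡
               suc (toℕ (lookup (k₀ ∷ k₁ ∷ k₂ ∷ k₃ ∷ k₄ ∷ []) (Fin.inject₁ i)))
    adjacent #0 ()
    adjacent #3 ()
    adjacent #1 _ = trans k₂≡ (trans (+-suc (length u) 0) (cong suc (sym k₁≡)))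
    adjacent #2 _ = trans k₃≡ (trans (+-suc (length u) 1) (cong suc (sym k₂≡)))

  letters-injective : ∀ {a b : Vec (Fin n) k} → letters a ≡ letters b → a ≡ b
  letters-injective {a = []}    {[]}    _  = refl
  letters-injective {a = _ ∷ _} {_ ∷ _} eq =
    cong₂ _∷_ (Fin.toℕ-injective (∷-injectiveˡ eq)) (letters-injective (∷-injectiveʳ eq))

  letters-! : ∀ {a : Vec (Fin n) k} → Vec.Unique a → Unique (letters a)
  letters-! Vecₚ.[]        = []
  letters-! (c∉a Vecₚ.∷ a!) = distinct c∉a ∷ letters-! a!
    where
    distinct : ∀ {k c} {a : Vec (Fin n) k} → Vec.All (c ≢_) a → All (toℕ c ≢_) (letters a)
    distinct Vec.[]         = []
    distinct (c≢ Vec.∷ c∉a) = (c≢ ∘ Fin.toℕ-injective) ∷ distinct c∉a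

  letters-!⁻ : ∀ (a : Vec (Fin n) k) → Unique (letters a) → Vec.Unique a
  letters-!⁻ []      _          = Vecₚ.[]
  letters-!⁻ (c ∷ a) (c∉a ∷ a!) = distinct a c∉a Vecₚ.∷ letters-!⁻ a a!
    where
    distinct : ∀ {k c} (a : Vec (Fin n) k) → All (toℕ c ≢_) (letters a) → Vec.All (c ≢_) a
    distinct []      []         = Vec.[]
    distinct (_ ∷ a) (c≢ ∷ c∉a) = (c≢ ∘ cong toℕ) Vec.∷ distinct a c∉a

  letters-length : ∀ (a : Vec (Fin n) k) → length (letters a) ≡ k
  letters-length []      = refl
  letters-length (_ ∷ a) = cong suc (letters-length a)

  letters-< : ∀ (a : Vec (Fin n) k) → All (_< n) (letters a)
  letters-< []      = []
  letters-< (c ∷ a) = Fin.toℕ<n c ∷ letters-< a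

  fromLetters : ∀ {w} → All (_< n) w → length w ≡ k → ∃ λ (a : Vec (Fin n) k) → letters a ≡ w
  fromLetters []          refl = [] , refl
  fromLetters (c<n ∷ w<n) refl with fromLetters w<n refl
  ... | a , eq = fromℕ< c<n ∷ a , cong₂ _∷_ (Fin.toℕ-fromℕ< c<n) eq

  ⊆-drop-mid : ∀ u {c : X} {s xs} → All (c ≢_) xs → xs ⊆ u ++ c ∷ s → xs ⊆ u ++ s
  ⊆-drop-mid u c∉xs xs⊆ d∈xs with ∈-++⁻ u (xs⊆ d∈xs)
  ... | inj₁ d∈u         = ∈-++⁺ˡ d∈u
  ... | inj₂ (here refl) = contradiction refl (All.lookup c∉xs d∈xs)
  ... | inj₂ (there d∈s) = ∈-++⁺ʳ u d∈s

  -- The entries of `xs` are removed from `ys` one at a time; `zs` is what is left over.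
  !-⊆⇒↭ : ∀ {xs ys : List X} → Unique xs → xs ⊆ ys → ∃ λ zs → ys ↭ xs ++ zs
  !-⊆⇒↭ {ys = ys} [] _ = ys , ↭-refl
  !-⊆⇒↭ {X} {c ∷ xs} (c∉xs ∷ xs!) xs⊆ys with ∈-∃++ (xs⊆ys (here refl))
  ... | u , s , refl with !-⊆⇒↭ xs! (⊆-drop-mid u c∉xs (xs⊆ys ∘ there))
  ...   | zs , p = zs , ↭-trans (shift c u s) (↭-prep c p)

  !-⊆⇒length≤ : ∀ {xs ys : List X} → Unique xs → xs ⊆ ys → length xs ≤ length ys
  !-⊆⇒length≤ {xs = xs} xs! xs⊆ys with !-⊆⇒↭ xs! xs⊆ys
  ... | zs , p = subst (length xs ≤_) (sym (trans (↭-length p) (length-++ xs))) (m≤m+n _ _)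

  -- Pigeonhole: any left-over letter would give `upTo n` more than `n` entries.
  permutation-↭ : ∀ {a : Vec (Fin n) n} → Vec.Unique a → letters a ↭ upTo n
  permutation-↭ {n} {a} a! with !-⊆⇒↭ (letters-! a!) (∈-upTo⁺ ∘ All.lookup (letters-< a))
  ... | [] , p = ↭-sym (↭-trans p (↭-reflexive (++-identityʳ _)))
  ... | z ∷ zs , p = contradiction eq (m≢1+m+n n)
    where
    open ≡-Reasoning
    eq : n ≡ suc (n + length zs)
    eq = begin
      n                                   ≡⟨ length-upTo n ⟨
      length (upTo n)                     ≡⟨ ↭-length p ⟩
      length (letters a ++ z ∷ zs)        ≡⟨ length-++ (letters a) ⟩
      length (letters a) + suc (length zs) ≡⟨ cong (_+ suc (length zs)) (letters-length a) ⟩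
      n + suc (length zs)                 ≡⟨ +-suc n (length zs) ⟩
      suc (n + length zs)                 ∎

  ++-!⁻ : ∀ (u : List X) {s} → Unique (u ++ s) → Unique u × Unique s
  ++-!⁻ []      s!         = [] , s!
  ++-!⁻ (_ ∷ u) (c∉ ∷ us!) with ++-!⁻ u us!
  ... | u! , s! = All.++⁻ˡ u c∉ ∷ u! , s!

  ↭-! : ∀ {xs ys : List X} → xs ↭ ys → Unique xs → Unique ys
  ↭-! p = Unique-resp-↭ (↭⇒↭ₛ p)
    where
    open import Data.List.Relation.Binary.Permutation.Setoid.Properties (setoid _)
      using (Unique-resp-↭)

  ↭-permutation : ∀ {w} → w ↭ upTo n → ∃ λ (a : Vec (Fin n) n) → letters a ≡ w × Vec.Unique a
  ↭-permutation {n} p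
    with fromLetters (All.tabulate (∈-upTo⁻ ∘ ∈-resp-↭ p)) (trans (↭-length p) (length-upTo n))
  ... | a , eq = a , eq , letters-!⁻ a (subst Unique (sym eq) (↭-! (↭-sym p) (Unique.upTo⁺ n)))

  one : Stat
  one _ _ = 1

  join : ℕ → Arrangement → List ℕ
  join n (l , r) = l ++ n ∷ reverse r

  weight-one : ∀ l r → Unique l → Unique r →
               (Peak Leftˢ l ⊎ Peak Leftˢ r) × weight (l , r) one ≡ 0 ⊎
               ¬ (Peak Leftˢ l ⊎ Peak Leftˢ r) × weight (l , r) one ≡ 1
  weight-one l r l! r! with verdict-start l l! | verdict-start r r!
  ... | inj₁ (bad , eq)  | _                = inj₁ (inj₁ bad , eq _)
  ... | inj₂ (_ , eq)    | inj₁ (bad , eq′) =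
    inj₁ (inj₂ bad , trans (run-cong start l (λ _ _ → eq′ one)) (eq 0))
  ... | inj₂ (good , eq) | inj₂ (good′ , eq′) =
    inj₂ (Sum.[ good , good′ ] , trans (run-cong start l (λ _ _ → eq′ 1)) (eq 1))

  length-filter-∑ : ∀ (f : X → ℕ) xs → (∀ {a} → a ∈ xs → f a ≡ 0 ⊎ f a ≡ 1) →
                    length (filter (λ a → f a ≟ 1) xs) ≡ ∑ xs f
  length-filter-∑ f []       _  = refl
  length-filter-∑ f (a ∷ xs) f∈01 with f∈01 (here refl)
  ... | inj₁ eq rewrite eq = length-filter-∑ f xs (f∈01 ∘ there)
  ... | inj₂ eq rewrite eq = cong suc (length-filter-∑ f xs (f∈01 ∘ there))

  ++-∷-injective : ∀ {c : X} u u′ {s s′} → c ∉ u → c ∉ u′ →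
                   u ++ c ∷ s ≡ u′ ++ c ∷ s′ → u ≡ u′ × s ≡ s′
  ++-∷-injective []      []       _ _ refl = refl , refl
  ++-∷-injective []      (_ ∷ _)  _ c∉ refl = contradiction (here refl) c∉
  ++-∷-injective (_ ∷ _) []       c∉ _ refl = contradiction (here refl) c∉
  ++-∷-injective (_ ∷ u) (_ ∷ u′) c∉ c∉′ eq with ∷-injective eq
  ... | refl , eq′ with ++-∷-injective u u′ (c∉ ∘ there) (c∉′ ∘ there) eq′
  ...   | refl , refl = refl , refl

  map-!-on : ∀ (f : X → Y) {xs} → (∀ {a b} → a ∈ xs → b ∈ xs → f a ≡ f b → a ≡ b) →
             Unique xs → Unique (map f xs)
  map-!-on f inj []          = []
  map-!-on f inj (a∉ ∷ xs!) =
    All.map⁺ (All.tabulate λ b∈ fa≡fb → All.lookup a∉ b∈ (inj (here refl) (there b∈) fa≡fb)) ∷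
    map-!-on f (λ a∈ b∈ → inj (there a∈) (there b∈)) xs!

  words-! : ∀ n k → Unique (words n k)
  words-! n zero    = [] ∷ []
  words-! n (suc k) =
    Unique.cartesianProductWith⁺ _∷_ Vec.∷-injective (Unique.allFin⁺ n) (words-! n k)

  avoider? : (a : Vec (Fin n) n) → Dec (IsPermutation a × Avoids 3-121-3 a)
  avoider? a = isPermutation? a ×-dec avoids? 3-121-3 a

  module _ (n : ℕ) where

    good? : (p : Arrangement) → Dec (weight p one ≡ 1)
    good? p = weight p one ≟ 1

    accepted : List Arrangement
    accepted = filter good? (arrangements n)

    avoiders : List (Vec (Fin (suc n)) (suc n))
    avoiders = filter avoider? (words (suc n) (suc n))

    upTo-mid : ∀ l r → l ++ n ∷ reverse r ↭ upTo (suc n) → l ++ r ↭ upTo n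
    upTo-mid l r p = ↭-trans (++⁺ˡ l (↭-sym (↭-reverse r)))
      (↭-trans (drop-mid l (upTo n) (↭-trans p (↭-reflexive (sym (upTo-∷ʳ n)))))
               (↭-reflexive (++-identityʳ (upTo n))))

    upTo-mid⁻ : ∀ l r → l ++ r ↭ upTo n → l ++ n ∷ reverse r ↭ upTo (suc n)
    upTo-mid⁻ l r p = begin
      l ++ n ∷ reverse r  ↭⟨ shift n l (reverse r) ⟩
      n ∷ l ++ reverse r  ↭⟨ ↭-prep n (++⁺ˡ l (↭-reverse r)) ⟩
      n ∷ l ++ r          ↭⟨ ↭-prep n p ⟩
      n ∷ upTo n          ↭⟨ ++-comm (n ∷ []) (upTo n) ⟩
      upTo n ++ n ∷ []    ≡⟨ upTo-∷ʳ n ⟩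
      upTo (suc n)        ∎
      where open PermutationReasoning

    module _ {l r} (p : l ++ r ↭ upTo n) where

      all< : All (_< n) (l ++ r)
      all< = All.tabulate (∈-upTo⁻ ∘ ∈-resp-↭ p)

      l! : Unique l
      l! = proj₁ (++-!⁻ l (↭-! (↭-sym p) (Unique.upTo⁺ n)))

      r! : Unique r
      r! = proj₂ (++-!⁻ l (↭-! (↭-sym p) (Unique.upTo⁺ n)))

      l< : All (_< n) l
      l< = All.++⁻ˡ l all<

      r<ʳ : All (_< n) (reverse r)
      r<ʳ = All-resp-↭ (↭-sym (↭-reverse r)) (All.++⁻ʳ l all<)

      Peak⇒sides : Peak Both (join n (l , r)) → Peak Leftˢ l ⊎ Peak Leftˢ r
      Peak⇒sides pk = Sum.map₂ Peak-Right⇒Left (Peak-join⁻ l< r<ʳ pk)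

      sides⇒Peak : Peak Leftˢ l ⊎ Peak Leftˢ r → Peak Both (join n (l , r))
      sides⇒Peak = Sum.[ Peak-join⁺ˡ l< r<ʳ , Peak-join⁺ʳ l< r<ʳ ∘ Peak-Left⇒Right ]

    -- So the first `n` in `join n p` marks the boundary between the sides, and `join n` is
    -- injective on arrangements.
    n∉ : ∀ {p} → p ∈ arrangements n → n ∉ proj₁ p
    n∉ p∈ n∈ = <-irrefl refl (All.lookup (l< (arrangement⇒↭ n p∈)) n∈)

    weight-01 : ∀ {p} → p ∈ arrangements n → weight p one ≡ 0 ⊎ weight p one ≡ 1
    weight-01 {l , r} p∈ = Sum.map proj₂ proj₂ (weight-one l r (l! p) (r! p))
      where p = arrangement⇒↭ n p∈

    avoider⇒accepted : ∀ (a : Vec (Fin (suc n)) (suc n)) → IsPermutation a → Avoids 3-121-3 a →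
                       letters a ∈ map (join n) accepted
    avoider⇒accepted a a! avoid
      with ∈-∃++ (∈-resp-↭ (↭-sym (permutation-↭ a!)) (∈-upTo⁺ {suc n} ≤-refl))
    ... | l , r′ , split = subst (_∈ map (join n) accepted) (sym eq)
      (∈-map⁺ (join n) (∈-filter⁺ good? (↭⇒arrangement n p) good))
      where
      r = reverse r′

      eq : letters a ≡ join n (l , r)
      eq = trans split (cong (λ t → l ++ n ∷ t) (sym (reverse-involutive r′)))

      p : l ++ r ↭ upTo n
      p = upTo-mid l r (subst (_↭ upTo (suc n)) eq (permutation-↭ a!))

      good : weight (l , r) one ≡ 1
      good with weight-one l r (l! p) (r! p)
      ... | inj₂ (_ , w≡1) = w≡1
      ... | inj₁ (bad , _) =
        contradiction (Peak⇒Occurrence a (subst (Peak Both) (sym eq) (sides⇒Peak p bad))) avoid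

    accepted⇒avoider : ∀ {p} → p ∈ arrangements n → weight p one ≡ 1 →
                       ∃ λ (a : Vec (Fin (suc n)) (suc n)) →
                         letters a ≡ join n p × IsPermutation a × Avoids 3-121-3 a
    accepted⇒avoider {l , r} p∈ w≡1 with ↭-permutation (upTo-mid⁻ l r (arrangement⇒↭ n p∈))
    ... | a , eq , a! = a , eq , a! , avoid
      where
      p = arrangement⇒↭ n p∈

      avoid : Avoids 3-121-3 a
      avoid (_ , occ) with weight-one l r (l! p) (r! p)
      ... | inj₁ (_ , w≡0)  = contradiction (trans (sym w≡0) w≡1) λ ()
      ... | inj₂ (good , _) = good (Peak⇒sides p (subst (Peak Both) eq (Occurrence⇒Peak occ)))

    avoiders⊆accepted : map letters avoiders ⊆ map (join n) accepted
    avoiders⊆accepted w∈ =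
      let a , a∈ , eq      = ∈-map⁻ letters w∈
          _ , (a! , avoid) = ∈-filter⁻ avoider? {xs = words (suc n) (suc n)} a∈
      in subst (_∈ map (join n) accepted) (sym eq) (avoider⇒accepted a a! avoid)

    accepted⊆avoiders : map (join n) accepted ⊆ map letters avoiders
    accepted⊆avoiders w∈ =
      let p , p∈acc , eq  = ∈-map⁻ (join n) w∈
          p∈ , w≡1        = ∈-filter⁻ good? {xs = arrangements n} p∈acc
          a , eq′ , proof = accepted⇒avoider p∈ w≡1
      in subst (_∈ map letters avoiders) (trans eq′ (sym eq))
               (∈-map⁺ letters (∈-filter⁺ avoider? (∈-words a) proof))

    accepted-! : Unique (map (join n) accepted)
    accepted-! = map-!-on (join n) inj (Unique.filter⁺ good? (arrangements-! n))
      where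
      inj : ∀ {p q} → p ∈ accepted → q ∈ accepted → join n p ≡ join n q → p ≡ q
      inj {l , r} {l′ , r′} p∈ q∈ eq
        with ++-∷-injective l l′ (n∉ (proj₁ (∈-filter⁻ good? p∈)))
                                 (n∉ (proj₁ (∈-filter⁻ good? q∈))) eq
      ... | eqˡ , eqʳ = cong₂ _,_ eqˡ (reverse-injective eqʳ)

    -- Two duplicate-free lists of words that include each other have equal lengths. As weights of
    -- arrangements are 0 or 1, counting those of weight 1 amounts to summing the weights.
    numberAvoiding-total : numberAvoiding 3-121-3 (suc n) ≡ total n 0 0
    numberAvoiding-total = begin
      length avoiders                    ≡⟨ length-map letters avoiders ⟨
      length (map letters avoiders)      ≡⟨ ≤-antisym
        (!-⊆⇒length≤ (Unique.map⁺ letters-injective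
                       (Unique.filter⁺ avoider? (words-! (suc n) (suc n)))) avoiders⊆accepted)
        (!-⊆⇒length≤ accepted-! accepted⊆avoiders) ⟩
      length (map (join n) accepted)     ≡⟨ length-map (join n) accepted ⟩
      length accepted                    ≡⟨
        length-filter-∑ (λ p → weight p one) (arrangements n) weight-01 ⟩
      ∑ (arrangements n) (λ p → weight p one) ≡⟨ ∑-arrangements 0 n ⟩
      total (n + 0) 0 0                  ≡⟨ cong (λ m → total m 0 0) (+-identityʳ n) ⟩
      total n 0 0                        ∎
      where open ≡-Reasoning

open import Defs
open Arrangements using (total)
open Counting using (numberAvoiding-total)
open import Data.Integer.Base as ℤ using (+_)
import Data.Integer.Properties as ℤ
open import Data.Fin.Base using (toℕ)
open import Data.Nat.Base as ℕ using (ℕ; zero; suc; pred; _!; _≤_; _<_; z≤n; s≤s; s≤s⁻¹; NonZero)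
import Data.Nat.Properties as ℕ
open import Data.Rational.Base as ℚ using (ℚ; 0ℚ; 1ℚ; ½; _/_; fromℚᵘ; toℚᵘ)
import Data.Rational.Properties as ℚ
import Data.Rational.Unnormalised.Base as ℚᵘ
import Data.Rational.Unnormalised.Properties as ℚᵘ
open import Data.Rational.Solver using (module +-*-Solver)
open import Algebra.Bundles using (CommutativeSemigroup)
open import Algebra.Properties.CommutativeMonoid.Sum ℚ.+-0-commutativeMonoid using (sum-syntax)
open import Data.Product.Base using (_,_)
open import Function.Base using (_∘_)
open import Relation.Binary.Bundles using (Setoid)
open import Relation.Binary.PropositionalEquality
import Relation.Binary.Reasoning.Setoid as SetoidReasoning

-- Natural numbers and their reciprocals in ℚ

fromℚᵘ-homo-+ : ∀ p q → fromℚᵘ p ℚ.+ fromℚᵘ q ≡ fromℚᵘ (p ℚᵘ.+ q)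
fromℚᵘ-homo-+ p q = ℚ.toℚᵘ-injective (begin
  toℚᵘ (fromℚᵘ p ℚ.+ fromℚᵘ q)          ≈⟨ ℚ.toℚᵘ-homo-+ (fromℚᵘ p) (fromℚᵘ q) ⟩
  toℚᵘ (fromℚᵘ p) ℚᵘ.+ toℚᵘ (fromℚᵘ q)  ≈⟨ ℚᵘ.+-cong (ℚ.toℚᵘ-fromℚᵘ p) (ℚ.toℚᵘ-fromℚᵘ q) ⟩
  p ℚᵘ.+ q                              ≈⟨ ℚ.toℚᵘ-fromℚᵘ (p ℚᵘ.+ q) ⟨
  toℚᵘ (fromℚᵘ (p ℚᵘ.+ q))              ∎)
  where open SetoidReasoning ℚᵘ.≃-setoid

fromℚᵘ-homo-* : ∀ p q → fromℚᵘ p ℚ.* fromℚᵘ q ≡ fromℚᵘ (p ℚᵘ.* q)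
fromℚᵘ-homo-* p q = ℚ.toℚᵘ-injective (begin
  toℚᵘ (fromℚᵘ p ℚ.* fromℚᵘ q)          ≈⟨ ℚ.toℚᵘ-homo-* (fromℚᵘ p) (fromℚᵘ q) ⟩
  toℚᵘ (fromℚᵘ p) ℚᵘ.* toℚᵘ (fromℚᵘ q)  ≈⟨ ℚᵘ.*-cong (ℚ.toℚᵘ-fromℚᵘ p) (ℚ.toℚᵘ-fromℚᵘ q) ⟩
  p ℚᵘ.* q                              ≈⟨ ℚ.toℚᵘ-fromℚᵘ (p ℚᵘ.* q) ⟨
  toℚᵘ (fromℚᵘ (p ℚᵘ.* q))              ∎)
  where open SetoidReasoning ℚᵘ.≃-setoid

ι : ℕ → ℚ
ι n = + n / 1

-- Normalisation by the gcd blocks computation with variables in ℚ, so the identity is checked on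
-- unnormalised fractions and carried over.
ι-+ : ∀ m n → ι (m ℕ.+ n) ≡ ι m ℚ.+ ι n
ι-+ m n = sym (trans (fromℚᵘ-homo-+ (ℚᵘ.mkℚᵘ (+ m) 0) (ℚᵘ.mkℚᵘ (+ n) 0))
  (cong (_/ 1) (cong₂ ℤ._+_ (ℤ.*-identityʳ (+ m)) (ℤ.*-identityʳ (+ n)))))

ι-* : ∀ m n → ι (m ℕ.* n) ≡ ι m ℚ.* ι n
ι-* m n = sym (trans (fromℚᵘ-homo-* (ℚᵘ.mkℚᵘ (+ m) 0) (ℚᵘ.mkℚᵘ (+ n) 0))
  (cong (_/ 1) (sym (ℤ.pos-* m n))))

/-≡ι* : ∀ c d .{{_ : NonZero d}} → + c / d ≡ ι c ℚ.* (+ 1 / d)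
/-≡ι* c d@(suc d-1) = sym (trans (fromℚᵘ-homo-* (ℚᵘ.mkℚᵘ (+ c) 0) (ℚᵘ.mkℚᵘ (+ 1) d-1))
  (ℚ./-cong (ℤ.*-identityʳ (+ c)) (ℕ.+-identityʳ d)))

ι-inverseʳ : ∀ d .{{_ : NonZero d}} → ι d ℚ.* (+ 1 / d) ≡ 1ℚ
ι-inverseʳ d@(suc d-1) = trans (sym (/-≡ι* d d))
  (ℚ.fromℚᵘ-cong {ℚᵘ.mkℚᵘ (+ d) d-1} {ℚᵘ.1ℚᵘ} (ℚᵘ.*≡* (ℤ.*-comm (+ d) (+ 1))))

-- The commutative algebra of formal power series

≈-setoid : Setoid _ _
≈-setoid = record
  { Carrier = Series
  ; _≈_ = _≈_
  ; isEquivalence = record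
    { refl  = λ _ → refl
    ; sym   = λ f≈g n → sym (f≈g n)
    ; trans = λ f≈g g≈h n → trans (f≈g n) (g≈h n)
    }
  }

open Setoid ≈-setoid using () renaming (refl to ≈-refl; trans to ≈-trans)
open +-*-Solver using (solve; _:+_; _:*_; _:-_; _:=_; con)

0# : Series
0# _ = 0ℚ

+-cong : ∀ {f f′ g g′} → f ≈ f′ → g ≈ g′ → f + g ≈ f′ + g′
+-cong f≈ g≈ n = cong₂ ℚ._+_ (f≈ n) (g≈ n)

+-congˡ : ∀ f {g g′} → g ≈ g′ → f + g ≈ f + g′
+-congˡ f = +-cong {f} ≈-refl

·-cong : ∀ q {f g} → f ≈ g → q · f ≈ q · g
·-cong q f≈g n = cong (q ℚ.*_) (f≈g n)

tail : Series → Series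
tail f = f ∘ suc

-- Agreement up to degree `n` is all that can be had when `exp` is replaced by one fixed partial
-- sum.
*-cong-≤ : ∀ {f f′ g g′} n → (∀ {i} → i ≤ n → f i ≡ f′ i) → (∀ {i} → i ≤ n → g i ≡ g′ i) →
           (f * g) n ≡ (f′ * g′) n
*-cong-≤ zero    f≡ g≡ = cong (ℚ._+ 0ℚ) (cong₂ ℚ._*_ (f≡ z≤n) (g≡ z≤n))
*-cong-≤ (suc n) f≡ g≡ = cong₂ ℚ._+_ (cong₂ ℚ._*_ (f≡ z≤n) (g≡ ℕ.≤-refl))
  (*-cong-≤ n (λ i≤n → f≡ (s≤s i≤n)) (λ i≤n → g≡ (ℕ.m≤n⇒m≤1+n i≤n)))

*-cong : ∀ {f f′ g g′} → f ≈ f′ → g ≈ g′ → f * g ≈ f′ * g′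
*-cong f≈ g≈ n = *-cong-≤ n (λ {i} _ → f≈ i) (λ {i} _ → g≈ i)

*-congˡ : ∀ f {g g′} → g ≈ g′ → f * g ≈ f * g′
*-congˡ f = *-cong {f} ≈-refl

*-congʳ : ∀ g {f f′} → f ≈ f′ → f * g ≈ f′ * g
*-congʳ g f≈ = *-cong {g = g} f≈ ≈-refl

*-zeroˡ : ∀ f → 0# * f ≈ 0#
*-zeroˡ f zero    = cong (ℚ._+ 0ℚ) (ℚ.*-zeroˡ (f 0))
*-zeroˡ f (suc n) = cong₂ ℚ._+_ (ℚ.*-zeroˡ (f (suc n))) (*-zeroˡ f n)

-- The product unfolds by definition at the constant term of `f`; this peels off the other end, and
-- commutativity follows by induction.
*-unfoldʳ : ∀ f g n → (f * g) (suc n) ≡ f (suc n) ℚ.* g 0 ℚ.+ (f * tail g) n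
*-unfoldʳ f g zero    =
  solve 4 (λ a b c d → a :* b :+ (c :* d :+ con 0ℚ) := c :* d :+ (a :* b :+ con 0ℚ)) refl
    (f 0) (g 1) (f 1) (g 0)
*-unfoldʳ f g (suc n) = trans
  (cong (f 0 ℚ.* g (2 ℕ.+ n) ℚ.+_) (*-unfoldʳ (tail f) g n))
  (solve 3 (λ a b c → a :+ (b :+ c) := b :+ (a :+ c)) refl
    (f 0 ℚ.* g (2 ℕ.+ n)) (f (2 ℕ.+ n) ℚ.* g 0) ((tail f * tail g) n))

*-comm : ∀ f g → f * g ≈ g * f
*-comm f g zero    = cong (ℚ._+ 0ℚ) (ℚ.*-comm (f 0) (g 0))
*-comm f g (suc n) = trans
  (cong₂ ℚ._+_ (ℚ.*-comm (f 0) (g (suc n))) (*-comm (tail f) g n))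
  (sym (*-unfoldʳ g f n))

*-distribʳ-+ : ∀ h f g → (f + g) * h ≈ f * h + g * h
*-distribʳ-+ h f g zero    =
  solve 3 (λ a b c → (a :+ b) :* c :+ con 0ℚ := a :* c :+ con 0ℚ :+ (b :* c :+ con 0ℚ)) refl
    (f 0) (g 0) (h 0)
*-distribʳ-+ h f g (suc n) = trans
  (cong ((f 0 ℚ.+ g 0) ℚ.* h (suc n) ℚ.+_) (*-distribʳ-+ h (tail f) (tail g) n))
  (solve 5 (λ a b c d e → (a :+ b) :* c :+ (d :+ e) := a :* c :+ d :+ (b :* c :+ e)) refl
    (f 0) (g 0) (h (suc n)) ((tail f * h) n) ((tail g * h) n))

*-distribˡ-+ : ∀ h f g → h * (f + g) ≈ h * f + h * g
*-distribˡ-+ h f g = ≈-trans (*-comm h (f + g))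
  (≈-trans (*-distribʳ-+ h f g) (+-cong (*-comm f h) (*-comm g h)))

·-*-assoc : ∀ q f g → (q · f) * g ≈ q · (f * g)
·-*-assoc q f g zero    =
  solve 3 (λ q a b → q :* a :* b :+ con 0ℚ := q :* (a :* b :+ con 0ℚ)) refl q (f 0) (g 0)
·-*-assoc q f g (suc n) = trans
  (cong (q ℚ.* f 0 ℚ.* g (suc n) ℚ.+_) (·-*-assoc q (tail f) g n))
  (solve 4 (λ q a b c → q :* a :* b :+ q :* c := q :* (a :* b :+ c)) refl
    q (f 0) (g (suc n)) ((tail f * g) n))

*-·-comm : ∀ q f g → f * (q · g) ≈ q · (f * g)
*-·-comm q f g = ≈-trans (*-comm f (q · g)) (≈-trans (·-*-assoc q g f) (·-cong q (*-comm g f)))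

*-assoc : ∀ f g h → (f * g) * h ≈ f * (g * h)
*-assoc f g h zero    =
  solve 3 (λ a b c → (a :* b :+ con 0ℚ) :* c :+ con 0ℚ := a :* (b :* c :+ con 0ℚ) :+ con 0ℚ) refl
    (f 0) (g 0) (h 0)
*-assoc f g h (suc n) = begin
  -- By definition `tail (f * g)` is `f 0 · tail g + tail f * g`.
  (f 0 ℚ.* g 0 ℚ.+ 0ℚ) ℚ.* h (suc n) ℚ.+ ((f 0 · tail g + tail f * g) * h) n
    ≡⟨ cong ((f 0 ℚ.* g 0 ℚ.+ 0ℚ) ℚ.* h (suc n) ℚ.+_) (trans
         (*-distribʳ-+ h (f 0 · tail g) (tail f * g) n)
         (cong₂ ℚ._+_ (·-*-assoc (f 0) (tail g) h n) (*-assoc (tail f) g h n))) ⟩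
  (f 0 ℚ.* g 0 ℚ.+ 0ℚ) ℚ.* h (suc n) ℚ.+ (f 0 ℚ.* (tail g * h) n ℚ.+ (tail f * (g * h)) n)
    ≡⟨ solve 5 (λ a b c d e → (a :* b :+ con 0ℚ) :* c :+ (a :* d :+ e) := a :* (b :* c :+ d) :+ e) refl
         (f 0) (g 0) (h (suc n)) ((tail g * h) n) ((tail f * (g * h)) n) ⟩
  f 0 ℚ.* (g 0 ℚ.* h (suc n) ℚ.+ (tail g * h) n) ℚ.+ (tail f * (g * h)) n ∎
  where open ≡-Reasoning

*-identityˡ : ∀ f → 1# * f ≈ f
*-identityˡ f zero    = solve 1 (λ a → con 1ℚ :* a :+ con 0ℚ := a) refl (f 0)
*-identityˡ f (suc n) = trans (cong (1ℚ ℚ.* f (suc n) ℚ.+_) (*-zeroˡ f n))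
  (solve 1 (λ a → con 1ℚ :* a :+ con 0ℚ := a) refl (f (suc n)))

*-commutativeSemigroup : CommutativeSemigroup _ _
*-commutativeSemigroup = record
  { Carrier = Series
  ; _≈_ = _≈_
  ; _∙_ = _*_
  ; isCommutativeSemigroup = record
    { isSemigroup = record
      { isMagma = record
        { isEquivalence = Setoid.isEquivalence ≈-setoid
        ; ∙-cong = *-cong
        }
      ; assoc = *-assoc
      }
    ; comm = *-comm
    }
  }

open import Algebra.Properties.CommutativeSemigroup *-commutativeSemigroup
  using (x∙yz≈y∙xz)
module ≈-Reasoning = SetoidReasoning ≈-setoid

-- Derivatives

∂ : Series → Series
∂ f n = ι (suc n) ℚ.* f (suc n)

∂-· : ∀ q f → ∂ (q · f) ≈ q · ∂ f
∂-· q f n = solve 3 (λ i q a → i :* (q :* a) := q :* (i :* a)) refl (ι (suc n)) q (f (suc n))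

∂-+ : ∀ f g → ∂ (f + g) ≈ ∂ f + ∂ g
∂-+ f g n = ℚ.*-distribˡ-+ (ι (suc n)) (f (suc n)) (g (suc n))

∂1# : ∂ 1# ≈ 0#
∂1# n = ℚ.*-zeroʳ (ι (suc n))

∂x : ∂ x ≈ 1#
∂x zero    = refl
∂x (suc n) = ℚ.*-zeroʳ (ι (2 ℕ.+ n))

-- The Euler operator x d/dx. It preserves degrees, so its product rule goes through the convolution
-- without an index shift; `∂ f` is `tail (θ f)`.
θ : Series → Series
θ f n = ι n ℚ.* f n

θ-* : ∀ f g → θ (f * g) ≈ θ f * g + f * θ g
θ-* f g n = go f g n
  where
  go : ∀ f g n → ι n ℚ.* (f * g) n ≡ (θ f * g) n ℚ.+ (f * θ g) n
  go f g zero = solve 2 (λ a b → con 0ℚ :* (a :* b :+ con 0ℚ) :=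
                  con 0ℚ :* a :* b :+ con 0ℚ :+ (a :* (con 0ℚ :* b) :+ con 0ℚ)) refl (f 0) (g 0)
  go f g (suc n) = trans
    (cong (λ i → i ℚ.* (f 0 ℚ.* g (suc n) ℚ.+ (tail f * g) n)) (ι-+ 1 n))
    (trans
      (trans
        (solve 4 (λ i a b c → (con 1ℚ :+ i) :* (a :* b :+ c) :=
                   (a :* ((con 1ℚ :+ i) :* b)) :+ (c :+ i :* c)) refl
          (ι n) (f 0) (g (suc n)) ((tail f * g) n))
        (cong₂ (λ i t → f 0 ℚ.* (i ℚ.* g (suc n)) ℚ.+ ((tail f * g) n ℚ.+ t))
               (sym (ι-+ 1 n)) (go (tail f) g n)))
      (trans
        (solve 6 (λ a b c d e z → a :+ (b :+ (c :+ d)) := con 0ℚ :* e :* z :+ (b :+ c) :+ (a :+ d)) refl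
          (f 0 ℚ.* (ι (suc n) ℚ.* g (suc n))) ((tail f * g) n) ((θ (tail f) * g) n) ((tail f * θ g) n)
          (f 0) (g (suc n)))
        (cong (λ t → ι 0 ℚ.* f 0 ℚ.* g (suc n) ℚ.+ t ℚ.+ (f 0 ℚ.* θ g (suc n) ℚ.+ (tail f * θ g) n))
              (trans (sym (*-distribʳ-+ g (tail f) (θ (tail f)) n)) (*-congʳ g tail-θ n)))))
    where
    tail-θ : tail f + θ (tail f) ≈ tail (θ f)
    tail-θ m = trans (solve 2 (λ i a → a :+ i :* a := (con 1ℚ :+ i) :* a) refl (ι m) (f (suc m)))
                     (cong (ℚ._* f (suc m)) (sym (ι-+ 1 m)))

∂-* : ∀ f g → ∂ (f * g) ≈ ∂ f * g + f * ∂ g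
∂-* f g n = trans (θ-* f g (suc n)) (cong₂ ℚ._+_
  (trans (cong (λ t → t ℚ.* g (suc n) ℚ.+ (∂ f * g) n) (ℚ.*-zeroˡ (f 0)))
         (solve 2 (λ a b → con 0ℚ :* a :+ b := b) refl (g (suc n)) ((∂ f * g) n)))
  (trans (*-unfoldʳ f (θ g) n)
         (solve 3 (λ a b c → a :* (con 0ℚ :* b) :+ c := c) refl (f (suc n)) (g 0) ((f * ∂ g) n))))

∂-^ : ∀ f k → ∂ (f ^ k) ≈ ι k · (∂ f * f ^ pred k)
∂-^ f zero = λ n → trans (∂1# n) (sym (ℚ.*-zeroˡ ((∂ f * 1#) n)))
∂-^ f (suc k) = begin
  ∂ (f * f ^ k)                             ≈⟨ ∂-* f (f ^ k) ⟩
  ∂ f * f ^ k + f * ∂ (f ^ k)               ≈⟨ +-congˡ (∂ f * f ^ k) (*-congˡ f (∂-^ f k)) ⟩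
  ∂ f * f ^ k + f * (ι k · (∂ f * f ^ pred k)) ≈⟨ +-congˡ (∂ f * f ^ k) (absorb k) ⟩
  ∂ f * f ^ k + ι k · (∂ f * f ^ k)         ≈⟨ (λ n → trans
      (solve 2 (λ i a → a :+ i :* a := (con 1ℚ :+ i) :* a) refl (ι k) ((∂ f * f ^ k) n))
      (cong (ℚ._* (∂ f * f ^ k) n) (sym (ι-+ 1 k)))) ⟩
  ι (suc k) · (∂ f * f ^ k)                 ∎
  where
  open ≈-Reasoning
  absorb : ∀ k → f * (ι k · (∂ f * f ^ pred k)) ≈ ι k · (∂ f * f ^ k)
  absorb zero    = ≈-trans (*-·-comm (ι 0) f (∂ f * 1#))
    (λ n → trans (ℚ.*-zeroˡ ((f * (∂ f * 1#)) n)) (sym (ℚ.*-zeroˡ ((∂ f * 1#) n))))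
  absorb (suc k) = ≈-trans (*-·-comm (ι (suc k)) f (∂ f * f ^ k))
    (·-cong (ι (suc k)) (x∙yz≈y∙xz f (∂ f) (f ^ k)))

-- The exponential series

partial : ℕ → (ℕ → ℚ) → ℚ
partial N F = ∑[ k < N ] F (toℕ k)

partial-cong : ∀ N {F G} → (∀ k → F k ≡ G k) → partial N F ≡ partial N G
partial-cong zero    eq = refl
partial-cong (suc N) eq = cong₂ ℚ._+_ (eq 0) (partial-cong N (eq ∘ suc))

partial-0 : ∀ N {F} → (∀ k → F k ≡ 0ℚ) → partial N F ≡ 0ℚ
partial-0 zero    eq = refl
partial-0 (suc N) eq = cong₂ ℚ._+_ (eq 0) (partial-0 N (eq ∘ suc))

partial-+ : ∀ M N F → partial (M ℕ.+ N) F ≡ partial M F ℚ.+ partial N (λ k → F (M ℕ.+ k))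
partial-+ zero    N F = sym (ℚ.+-identityˡ _)
partial-+ (suc M) N F = trans (cong (F 0 ℚ.+_) (partial-+ M N (F ∘ suc)))
  (sym (ℚ.+-assoc (F 0) (partial M (F ∘ suc)) _))

*-partial : ∀ q N F → q ℚ.* partial N F ≡ partial N (λ k → q ℚ.* F k)
*-partial q zero    F = ℚ.*-zeroʳ q
*-partial q (suc N) F = trans (ℚ.*-distribˡ-+ q (F 0) (partial N (F ∘ suc)))
  (cong (q ℚ.* F 0 ℚ.+_) (*-partial q N (F ∘ suc)))

*-partialˢ : ∀ g N (F : ℕ → Series) →
             g * (λ m → partial N (λ k → F k m)) ≈ (λ n → partial N (λ k → (g * F k) n))
*-partialˢ g zero    F = ≈-trans (*-comm g 0#) (*-zeroˡ g)
*-partialˢ g (suc N) F = ≈-trans (*-distribˡ-+ g (F 0) (λ m → partial N (λ k → F (suc k) m)))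
  (+-congˡ (g * F 0) (*-partialˢ g N (F ∘ suc)))

^-order : ∀ {f} → f 0 ≡ 0ℚ → ∀ {m k} → m < k → (f ^ k) m ≡ 0ℚ
^-order {f} f₀ {zero}  {suc k} _   = trans (cong (λ a → a ℚ.* (f ^ k) 0 ℚ.+ 0ℚ) f₀)
  (solve 1 (λ a → con 0ℚ :* a :+ con 0ℚ := con 0ℚ) refl ((f ^ k) 0))
^-order {f} f₀ {suc m} {suc k} m<k = trans
  (cong₂ (λ a b → a ℚ.* (f ^ k) (suc m) ℚ.+ b) f₀
    (trans (*-cong-≤ {tail f} m (λ _ → refl) (λ i≤m → ^-order f₀ (ℕ.≤-<-trans i≤m (s≤s⁻¹ m<k))))
           (≈-trans (*-comm (tail f) 0#) (*-zeroˡ (tail f)) m)))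
  (solve 1 (λ a → con 0ℚ :* a :+ con 0ℚ := con 0ℚ) refl ((f ^ k) (suc m)))

-- Powers above the degree vanish, so one bound `N` serves all degrees below it. A finite sum with a
-- fixed bound can then be pulled through a product.
exp-partial : ∀ {f} → f 0 ≡ 0ℚ → ∀ {m N} → m < N →
              partial N (λ k → 1/ k ! ℚ.* (f ^ k) m) ≡ exp f m
exp-partial {f} f₀ {m} {N} m<N with ℕ.m≤n⇒∃[o]m+o≡n m<N
... | o , refl = trans (partial-+ (suc m) o (λ k → 1/ k ! ℚ.* (f ^ k) m))
  (trans (cong (exp f m ℚ.+_) (partial-0 o λ k →
           trans (cong (1/ suc m ℕ.+ k ! ℚ.*_) (^-order {f} f₀ (ℕ.m≤m+n (suc m) k)))
               (ℚ.*-zeroʳ (1/ suc m ℕ.+ k !))))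
         (ℚ.+-identityʳ _))

ι-1/! : ∀ k → ι (suc k) ℚ.* 1/ suc k ! ≡ 1/ k !
ι-1/! k = trans (sym (ℚ.*-identityʳ _)) (trans (cong (ι (suc k) ℚ.* 1/ suc k ! ℚ.*_) (sym inv))
  (trans (solve 4 (λ s r f q → s :* r :* (f :* q) := s :* f :* r :* q) refl
            (ι (suc k)) (1/ suc k !) (ι (k !)) (1/ k !))
         (trans (cong (ℚ._* 1/ k !) (trans (cong (ℚ._* 1/ suc k !) (sym (ι-* (suc k) (k !)))) inv′))
                (ℚ.*-identityˡ _))))
  where
  inv : ι (k !) ℚ.* 1/ k ! ≡ 1ℚ
  inv = ι-inverseʳ (k !) {{k ℕ.!≢0}}
  inv′ : ι (suc k !) ℚ.* 1/ suc k ! ≡ 1ℚ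
  inv′ = ι-inverseʳ (suc k !) {{suc k ℕ.!≢0}}

∂-exp : ∀ {f} → f 0 ≡ 0ℚ → ∂ (exp f) ≈ ∂ f * exp f
∂-exp {f} f₀ n = begin
  ι (suc n) ℚ.* partial (2 ℕ.+ n) (λ k → 1/ k ! ℚ.* (f ^ k) (suc n))
    ≡⟨ *-partial (ι (suc n)) (2 ℕ.+ n) (λ k → 1/ k ! ℚ.* (f ^ k) (suc n)) ⟩
  partial (2 ℕ.+ n) (λ k → ι (suc n) ℚ.* (1/ k ! ℚ.* (f ^ k) (suc n)))
    -- The power with `k = 0` is constant and drops out; the others are matched with index `k` one
    -- lower.
    ≡⟨ cong₂ ℚ._+_
         (trans (cong (ι (suc n) ℚ.*_) (ℚ.*-zeroʳ (1/ 0 !))) (ℚ.*-zeroʳ (ι (suc n))))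
         (partial-cong (suc n) term) ⟩
  0ℚ ℚ.+ partial (suc n) (λ k → (∂ f * (1/ k ! · f ^ k)) n)
    ≡⟨ ℚ.+-identityˡ _ ⟩
  partial (suc n) (λ k → (∂ f * (1/ k ! · f ^ k)) n)
    ≡⟨ *-partialˢ (∂ f) (suc n) (λ k → 1/ k ! · f ^ k) n ⟨
  (∂ f * (λ m → partial (suc n) (λ k → 1/ k ! ℚ.* (f ^ k) m))) n
    ≡⟨ *-cong-≤ {∂ f} {g = λ m → partial (suc n) (λ k → 1/ k ! ℚ.* (f ^ k) m)} {exp f} n
                (λ _ → refl) (λ i≤n → exp-partial {f} f₀ (s≤s i≤n)) ⟩
  (∂ f * exp f) n ∎
  where
  open ≡-Reasoning
  term : ∀ k → ι (suc n) ℚ.* (1/ suc k ! ℚ.* (f ^ suc k) (suc n)) ≡ (∂ f * (1/ k ! · f ^ k)) n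
  term k = begin
    ι (suc n) ℚ.* (1/ suc k ! ℚ.* (f ^ suc k) (suc n))
      ≡⟨ solve 3 (λ i r a → i :* (r :* a) := r :* (i :* a)) refl
           (ι (suc n)) (1/ suc k !) ((f ^ suc k) (suc n)) ⟩
    1/ suc k ! ℚ.* ∂ (f ^ suc k) n
      ≡⟨ cong (1/ suc k ! ℚ.*_) (∂-^ f (suc k) n) ⟩
    1/ suc k ! ℚ.* (ι (suc k) ℚ.* (∂ f * f ^ k) n)
      ≡⟨ solve 3 (λ i r a → r :* (i :* a) := i :* r :* a) refl
           (ι (suc k)) (1/ suc k !) ((∂ f * f ^ k) n) ⟩
    ι (suc k) ℚ.* 1/ suc k ! ℚ.* (∂ f * f ^ k) n
      ≡⟨ cong (ℚ._* (∂ f * f ^ k) n) (ι-1/! k) ⟩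
    1/ k ! ℚ.* (∂ f * f ^ k) n
      ≡⟨ *-·-comm (1/ k !) (∂ f) (f ^ k) n ⟨
    (∂ f * (1/ k ! · f ^ k)) n ∎

-- The generating function of the number of continuations

-- With no letters left there is exactly one continuation, so `V`, `E` and `R` start with 1. This
-- fixes the constant in `E`; `F` is the antiderivative of `2ℚ · E` whose constant term is 0, as
-- `exp` requires.
V E F R : Series
V = exp (2ℚ · x)
E = ½ · (1# + V)
F = ½ · (exp (2ℚ · x) + 2ℚ · x - 1#)
R = exp F

∂V : ∂ V ≈ 2ℚ · V
∂V = begin
  ∂ V                 ≈⟨ ∂-exp {2ℚ · x} refl ⟩
  ∂ (2ℚ · x) * V      ≈⟨ *-congʳ V (≈-trans (∂-· 2ℚ x) (·-cong 2ℚ ∂x)) ⟩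
  (2ℚ · 1#) * V       ≈⟨ ·-*-assoc 2ℚ 1# V ⟩
  2ℚ · (1# * V)       ≈⟨ ·-cong 2ℚ (*-identityˡ V) ⟩
  2ℚ · V              ∎
  where open ≈-Reasoning

∂E : ∂ E ≈ V
∂E n = trans (∂-· ½ (1# + V) n) (trans
  (cong (½ ℚ.*_) (trans (∂-+ 1# V n) (cong₂ ℚ._+_ (∂1# n) (∂V n))))
  (solve 1 (λ a → con ½ :* (con 0ℚ :+ con 2ℚ :* a) := a) refl (V n)))

∂F : ∂ F ≈ 2ℚ · E
∂F n = trans
  (solve 4 (λ i v y z → i :* (con ½ :* (v :+ con 2ℚ :* y :- z)) :=
                        con ½ :* (i :* v :+ con 2ℚ :* (i :* y) :- i :* z)) refl
    (ι (suc n)) (V (suc n)) (x (suc n)) (1# (suc n)))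
  (trans
    (cong (½ ℚ.*_) (cong₂ ℚ._-_ (cong₂ ℚ._+_ (∂V n) (cong (2ℚ ℚ.*_) (∂x n))) (∂1# n)))
    (solve 2 (λ v o → con ½ :* (con 2ℚ :* v :+ con 2ℚ :* o :- con 0ℚ) :=
                      con 2ℚ :* (con ½ :* (o :+ v))) refl (V n) (1# n)))

∂R : ∂ R ≈ 2ℚ · (E * R)
∂R = ≈-trans (∂-exp {F} refl) (≈-trans (*-congʳ R ∂F) (·-*-assoc 2ℚ E R))

∂V^ : ∀ v → ∂ (V ^ v) ≈ ι (2 ℕ.* v) · V ^ v
∂V^ zero    n = trans (∂1# n) (sym (ℚ.*-zeroˡ (1# n)))
∂V^ (suc v) = begin
  ∂ (V ^ suc v)                           ≈⟨ ∂-^ V (suc v) ⟩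
  ι (suc v) · (∂ V * V ^ v)               ≈⟨ ·-cong (ι (suc v)) (≈-trans (*-congʳ (V ^ v) ∂V)
                                                                    (·-*-assoc 2ℚ V (V ^ v))) ⟩
  ι (suc v) · 2ℚ · V ^ suc v              ≈⟨ (λ n → trans
      (solve 2 (λ i a → i :* (con 2ℚ :* a) := con 2ℚ :* i :* a) refl (ι (suc v)) ((V ^ suc v) n))
      (cong (ℚ._* (V ^ suc v) n) (sym (ι-* 2 (suc v))))) ⟩
  ι (2 ℕ.* suc v) · V ^ suc v             ∎
  where open ≈-Reasoning

-- The exponential generating function of n ↦ total n e v: with E ′ = V and V ′ = 2 V, each
-- summand of ∂ (G e v) is one way of inserting the next letter.
G : ℕ → ℕ → Series
G e v = E ^ e * (V ^ v * R)

∂G : ∀ e v → ∂ (G e v) ≈ 2ℚ · G (suc e) v + (ι e · G (pred e) (suc v) + ι (2 ℕ.* v) · G e v)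
∂G e v = begin
  ∂ (G e v)
    ≈⟨ ∂-* (E ^ e) (V ^ v * R) ⟩
  ∂ (E ^ e) * (V ^ v * R) + E ^ e * ∂ (V ^ v * R)
    ≈⟨ +-cong partE (≈-trans (*-congˡ (E ^ e) (∂-* (V ^ v) R))
                             (*-distribˡ-+ (E ^ e) (∂ (V ^ v) * R) (V ^ v * ∂ R))) ⟩
  ι e · G (pred e) (suc v) + (E ^ e * (∂ (V ^ v) * R) + E ^ e * (V ^ v * ∂ R))
    ≈⟨ +-congˡ (ι e · G (pred e) (suc v)) (+-cong partV partR) ⟩
  ι e · G (pred e) (suc v) + (ι (2 ℕ.* v) · G e v + 2ℚ · G (suc e) v)
    ≈⟨ (λ n → solve 3 (λ a b c → a :+ (b :+ c) := c :+ (a :+ b)) refl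
               ((ι e · G (pred e) (suc v)) n) ((ι (2 ℕ.* v) · G e v) n) ((2ℚ · G (suc e) v) n)) ⟩
  2ℚ · G (suc e) v + (ι e · G (pred e) (suc v) + ι (2 ℕ.* v) · G e v) ∎
  where
  open ≈-Reasoning
  partE : ∂ (E ^ e) * (V ^ v * R) ≈ ι e · G (pred e) (suc v)
  partE = begin
    ∂ (E ^ e) * (V ^ v * R)                      ≈⟨ *-congʳ (V ^ v * R) (∂-^ E e) ⟩
    (ι e · (∂ E * E ^ pred e)) * (V ^ v * R)     ≈⟨ ·-*-assoc (ι e) (∂ E * E ^ pred e) (V ^ v * R) ⟩
    ι e · ((∂ E * E ^ pred e) * (V ^ v * R))     ≈⟨ ·-cong (ι e) (begin
        (∂ E * E ^ pred e) * (V ^ v * R)   ≈⟨ *-congʳ (V ^ v * R) (*-congʳ (E ^ pred e) ∂E) ⟩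
        (V * E ^ pred e) * (V ^ v * R)     ≈⟨ *-assoc V (E ^ pred e) (V ^ v * R) ⟩
        V * (E ^ pred e * (V ^ v * R))     ≈⟨ x∙yz≈y∙xz V (E ^ pred e) (V ^ v * R) ⟩
        E ^ pred e * (V * (V ^ v * R))     ≈⟨ *-congˡ (E ^ pred e) (*-assoc V (V ^ v) R) ⟨
        G (pred e) (suc v)                 ∎) ⟩
    ι e · G (pred e) (suc v)                     ∎

  partV : E ^ e * (∂ (V ^ v) * R) ≈ ι (2 ℕ.* v) · G e v
  partV = begin
    E ^ e * (∂ (V ^ v) * R)               ≈⟨ *-congˡ (E ^ e) (*-congʳ R (∂V^ v)) ⟩
    E ^ e * ((ι (2 ℕ.* v) · V ^ v) * R)   ≈⟨ *-congˡ (E ^ e) (·-*-assoc (ι (2 ℕ.* v)) (V ^ v) R) ⟩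
    E ^ e * (ι (2 ℕ.* v) · (V ^ v * R))   ≈⟨ *-·-comm (ι (2 ℕ.* v)) (E ^ e) (V ^ v * R) ⟩
    ι (2 ℕ.* v) · G e v                   ∎

  partR : E ^ e * (V ^ v * ∂ R) ≈ 2ℚ · G (suc e) v
  partR = begin
    E ^ e * (V ^ v * ∂ R)                ≈⟨ *-congˡ (E ^ e) (*-congˡ (V ^ v) ∂R) ⟩
    E ^ e * (V ^ v * (2ℚ · (E * R)))     ≈⟨ *-congˡ (E ^ e) (*-·-comm 2ℚ (V ^ v) (E * R)) ⟩
    E ^ e * (2ℚ · (V ^ v * (E * R)))     ≈⟨ *-·-comm 2ℚ (E ^ e) (V ^ v * (E * R)) ⟩
    2ℚ · (E ^ e * (V ^ v * (E * R)))     ≈⟨ ·-cong 2ℚ (begin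
        E ^ e * (V ^ v * (E * R))   ≈⟨ *-congˡ (E ^ e) (x∙yz≈y∙xz (V ^ v) E R) ⟩
        E ^ e * (E * (V ^ v * R))   ≈⟨ x∙yz≈y∙xz (E ^ e) E (V ^ v * R) ⟩
        E * (E ^ e * (V ^ v * R))   ≈⟨ *-assoc E (E ^ e) (V ^ v * R) ⟨
        G (suc e) v                 ∎) ⟩
    2ℚ · G (suc e) v                     ∎

^-constant : ∀ {f} → f 0 ≡ 1ℚ → ∀ k → (f ^ k) 0 ≡ 1ℚ
^-constant f₀ zero    = refl
^-constant f₀ (suc k) = cong₂ (λ a b → a ℚ.* b ℚ.+ 0ℚ) f₀ (^-constant f₀ k)

G-constant : ∀ e v → G e v 0 ≡ 1ℚ
G-constant e v = cong₂ (λ a b → a ℚ.* (b ℚ.* 1ℚ ℚ.+ 0ℚ) ℚ.+ 0ℚ)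
  (^-constant {E} refl e) (^-constant {V} refl v)

-- Both sides obey the same recursion in `n`, by `insert₂` and by `∂G`. It mixes different
-- statistics, so `e` and `v` vary in the induction.
total-G : ∀ n e v → ι (total n e v) ≡ ι (n !) ℚ.* G e v n
total-G zero    e v = sym (trans (ℚ.*-identityˡ (G e v 0)) (G-constant e v))
total-G (suc n) e v = begin
  ι (total n (suc e) v ℕ.+ (total n (suc e) v ℕ.+
     (e ℕ.* total n (pred e) (suc v) ℕ.+ 2 ℕ.* v ℕ.* total n e v)))
    ≡⟨ trans (ι-+ a (a ℕ.+ (e ℕ.* b ℕ.+ 2 ℕ.* v ℕ.* c))) (cong (ι a ℚ.+_)
       (trans (ι-+ a (e ℕ.* b ℕ.+ 2 ℕ.* v ℕ.* c)) (cong (ι a ℚ.+_)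
       (trans (ι-+ (e ℕ.* b) (2 ℕ.* v ℕ.* c)) (cong₂ ℚ._+_ (ι-* e b) (ι-* (2 ℕ.* v) c)))))) ⟩
  ι a ℚ.+ (ι a ℚ.+ (ι e ℚ.* ι b ℚ.+ ι (2 ℕ.* v) ℚ.* ι c))
    ≡⟨ cong₂ (λ p q → p ℚ.+ (p ℚ.+ q)) (total-G n (suc e) v)
         (cong₂ (λ p q → ι e ℚ.* p ℚ.+ ι (2 ℕ.* v) ℚ.* q)
                (total-G n (pred e) (suc v)) (total-G n e v)) ⟩
  f ℚ.* G (suc e) v n ℚ.+ (f ℚ.* G (suc e) v n ℚ.+
    (ι e ℚ.* (f ℚ.* G (pred e) (suc v) n) ℚ.+ ι (2 ℕ.* v) ℚ.* (f ℚ.* G e v n)))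
    ≡⟨ solve 6 (λ f p q r i j → f :* p :+ (f :* p :+ (i :* (f :* q) :+ j :* (f :* r))) :=
                                f :* (con 2ℚ :* p :+ (i :* q :+ j :* r))) refl
         f (G (suc e) v n) (G (pred e) (suc v) n) (G e v n) (ι e) (ι (2 ℕ.* v)) ⟩
  f ℚ.* (2ℚ · G (suc e) v + (ι e · G (pred e) (suc v) + ι (2 ℕ.* v) · G e v)) n
    ≡⟨ cong (f ℚ.*_) (∂G e v n) ⟨
  f ℚ.* (ι (suc n) ℚ.* G e v (suc n))
    ≡⟨ solve 3 (λ f i p → f :* (i :* p) := i :* f :* p) refl f (ι (suc n)) (G e v (suc n)) ⟩
  ι (suc n) ℚ.* f ℚ.* G e v (suc n)
    ≡⟨ cong (ℚ._* G e v (suc n)) (ι-* (suc n) (n !)) ⟨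
  ι (suc n !) ℚ.* G e v (suc n) ∎
  where
  open ≡-Reasoning
  a = total n (suc e) v
  b = total n (pred e) (suc v)
  c = total n e v
  f = ι (n !)

G₀₀ : G 0 0 ≈ R
G₀₀ = ≈-trans (*-identityˡ (1# * R)) (*-identityˡ R)

!-/ : ∀ n → ι (n !) ℚ.* 1/ suc n ! ≡ + 1 / suc n
!-/ n = begin
  f ℚ.* r
    ≡⟨ ℚ.*-identityʳ (f ℚ.* r) ⟨
  f ℚ.* r ℚ.* 1ℚ
    ≡⟨ cong (f ℚ.* r ℚ.*_) (ι-inverseʳ (suc n)) ⟨
  f ℚ.* r ℚ.* (i ℚ.* q)
    ≡⟨ solve 4 (λ f r i q → f :* r :* (i :* q) := i :* f :* r :* q) refl f r i q ⟩
  i ℚ.* f ℚ.* r ℚ.* q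
    ≡⟨ cong (λ t → t ℚ.* r ℚ.* q) (ι-* (suc n) (n !)) ⟨
  ι (suc n !) ℚ.* r ℚ.* q
    ≡⟨ cong (ℚ._* q) (ι-inverseʳ (suc n !) {{suc n ℕ.!≢0}}) ⟩
  1ℚ ℚ.* q
    ≡⟨ ℚ.*-identityˡ q ⟩
  q ∎
  where
  open ≡-Reasoning
  f = ι (n !)
  r = 1/ suc n !
  i = ι (suc n)
  q = + 1 / suc n

mainTheorem6 : egf (numberAvoiding 3-121-3) ≈ 1# + ∫ (exp (½ · (exp (2ℚ · x) + 2ℚ · x - 1#)))
-- The empty permutation has no maximum to build around; it accounts for the summand `1#`.
mainTheorem6 zero    = refl
mainTheorem6 (suc n) = begin
  (+ c / suc n !) {{suc n ℕ.!≢0}}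
    ≡⟨ /-≡ι* c (suc n !) {{suc n ℕ.!≢0}} ⟩
  ι c ℚ.* 1/ suc n !
    -- Only `n` of the `suc n` letters are inserted, the maximum being given; this shift of the
    -- index is the integral.
    ≡⟨ cong (λ m → ι m ℚ.* 1/ suc n !) (numberAvoiding-total n) ⟩
  ι (total n 0 0) ℚ.* 1/ suc n !
    ≡⟨ cong (ℚ._* 1/ suc n !) (trans (total-G n 0 0) (cong (ι (n !) ℚ.*_) (G₀₀ n))) ⟩
  ι (n !) ℚ.* R n ℚ.* 1/ suc n !
    ≡⟨ solve 3 (λ f r q → f :* r :* q := con 0ℚ :+ r :* (f :* q)) refl
         (ι (n !)) (R n) (1/ suc n !) ⟩
  0ℚ ℚ.+ R n ℚ.* (ι (n !) ℚ.* 1/ suc n !)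
    ≡⟨ cong (λ q → 0ℚ ℚ.+ R n ℚ.* q) (!-/ n) ⟩
  0ℚ ℚ.+ R n ℚ.* (+ 1 / suc n) ∎
  where
  open ≡-Reasoning
  c = numberAvoiding 3-121-3 (suc n)
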